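{- Let $E = \sum_{n=1}^{\infty} \frac{1}{2^n - 1} = \sum_{n=1}^{\infty} \frac{d(n)}{2^n}$ (the Erdős–Borwein constant). Then the block $11$ (two consecutive binary digits both equal to $1$) appears infinitely often in the base-$2$ expansion of $E$; that is, there are infinitely many positive integers $n$ such that the $n$-th and $(n+1)$-th binary digits of $E$ after the binary point are both equal to $1$.
   Context: For a positive integer $n$, $d(n)$ denotes the number of positive divisors of $n$. The constant $E$ is irrational, so its binary expansion is unique. -}

module Defs where

open import Data.Nat using (ℕ; zero; suc; _+_; _*_; _^_; _≤_; _<_; _≡ᵇ_)
open import Data.Nat.Properties using (m^n≢0)
open import Data.Nat.DivMod using (_/_; _%_)
open import Data.Nat.Divisibility using (_∣?_)
open import Data.List using (List; length; filter; map; upTo)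
open import Data.Product using (∃-syntax; _×_)
open import Relation.Binary.PropositionalEquality using (_≡_)

d : ℕ → ℕ
d n = length (filter (λ k → k ∣? n) (map suc (upTo n)))

-- A N = Σ_{k=1}^{N} d(k) 2^{N-k}, so that the N-th partial sum of
-- E = Σ_{k≥1} d(k)/2^k is S_N = A N / 2^N.
A : ℕ → ℕ
A zero = 0
A (suc N) = 2 * A N + d (suc N)

floorScaledPartial : ℕ → ℕ → ℕ
floorScaledPartial n N = (A N * 2 ^ n) / (2 ^ N)
  where instance _ = m^n≢0 2 N

-- The n-th binary digit of E after the binary point (n ≥ 1) is ⌊2^n E⌋ mod 2.
-- Since S_N increases to E and E is irrational, ⌊2^n S_N⌋ is eventually
-- equal to ⌊2^n E⌋; so "digit n of E equals b" means: for all large N,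
-- ⌊2^n S_N⌋ mod 2 = b.
EBinaryDigit≡ : ℕ → ℕ → Set
EBinaryDigit≡ n b = ∃[ M ] (∀ N → M ≤ N → floorScaledPartial n N % 2 ≡ b)

{-# OPTIONS --safe #-}

-- If S is an integer, d(S²) is odd and d(S² - 1) is even, so ⌊2^(S²) E⌋ ≡ 3 (mod 4) as soon as d(S²) ≡ 3 (mod 4),
-- 2^(i+2) ∣ d(S² + i) for 1 ≤ i ≤ K, and Σ_{i>K} d(S² + i)/2^i < 1; the digits S² - 1 and S² are then both 1.
-- For odd s, d(4s²) = 3 d(s²), so one of S = s, S = x = 2s satisfies the condition modulo 4, and since
-- 4(s² + i) = x² + 4i it is enough to control d(x² + i) for all i.
-- For i ≤ K, congruences on x make many pairwise coprime numbers c(b) = i F² b² + 1 (F = B!) exact divisors of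
-- x² + i. As c(b) c(b+1) is never a square, each pair of consecutive b contributes a factor 2 to d(x² + i).
-- For i > K, x runs through x₁ + tM with t < T, where log M is polynomial in K. A number n < T³ with
-- d(δ) ≤ D for all its divisors δ ≤ T has d(n) ≤ (2D)³. The congruence (x₁ + tM)² ≡ -i (mod δ) has at most
-- d(δ)·8i·gcd(M, x₁² + i)·T/δ solutions t < T, and Σ_{δ≤T} d(δ)²/δ ≤ (1 + log₂ T)⁴, so by Markov's inequality
-- some t avoids for every i the divisors δ ≤ T with d(δ) > 2^(i/48).
module Submission where

open import Defs
open import Data.Nat hiding (_/_; _%_)
open import Data.Nat.Properties
open import Data.Nat.Divisibility
open import Data.Nat.DivMod using (_/_; _%_; m≡m%n+[m/n]*n; m%n<n; [m+kn]%n≡m%n; m*n/n≡m; m*n/o*n≡m/o; m/n/o≡m/[n*o]; m*[n/m]≡n; +-distrib-/-∣ˡ; m<n⇒m/n≡0; m/n*n≤m; m%n≤n; m<n*o⇒m/o<n; /-monoˡ-≤)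
open import Data.Nat.GCD
open import Data.Nat.Coprimality using (Coprime; coprime-divisor; coprime-Bézout) renaming (sym to coprime-sym)
open import Data.Nat.Primality using (Prime; prime⇒irreducible; prime⇒nonTrivial)
open import Data.Nat.Primality.Factorisation using (factorise)
open import Data.Nat.Tactic.RingSolver using (solve-∀)
open import Data.List using (length; filter; applyUpTo; []; _∷_)
open import Data.List.Properties using (map-upTo)
open import Data.List.Relation.Unary.All using (_∷_)
open import Data.Product using (∃-syntax; _×_; _,_; proj₁; proj₂)
open import Data.Sum using (_⊎_; inj₁; inj₂)
open import Function using (_∘_)
open import Relation.Binary.Definitions using (tri<; tri≈; tri>)
open import Relation.Nullary using (¬_; Dec; yes; no; contradiction)
open import Relation.Nullary.Decidable using (_×-dec_)
open import Relation.Binary.PropositionalEquality using (_≡_; _≢_; refl; sym; trans; cong; cong₂; subst; module ≡-Reasoning)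

-- Finite sums and indicators

-- `d` is odd only at squares, so the position comes from a square and the averaging has to run over
-- values of a quadratic polynomial, not over an interval. The obstacle is the tail just beyond `K`.
-- No congruence controls `d` there, and the trivial `d n ≤ n` suffices only once `i` is a fixed
-- multiple of `log₂ T`; the averaging covers the range between. Along a progression of modulus `M`,
-- the danger is a divisor shared by `M` and the values, since then all `t` are affected alike. The
-- factor `F = B!` confines this: every `c(b)` is 1 modulo each number up to `B`, so for `K < i ≤ B`
-- only the factor 4 of `M` can be shared, and for `i > B` a crude bound `i^(2E)`, with `E` the
-- number of moduli, loses against `2^(i/48)`. The form of `c(b)` also supplies an explicit square
-- root `i F b` of `-i` modulo `c(b)`, so neither primes in progressions nor quadratic reciprocity
-- enter.

∑ : ℕ → (ℕ → ℕ) → ℕ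
∑ zero    f = 0
∑ (suc n) f = ∑ n f + f n

⟦_⟧ : ∀ {p} {P : Set p} → Dec P → ℕ
⟦ yes _ ⟧ = 1
⟦ no _ ⟧  = 0

⟦⟧-true : ∀ {p} {P : Set p} (P? : Dec P) → P → ⟦ P? ⟧ ≡ 1
⟦⟧-true (yes _) _ = refl
⟦⟧-true (no ¬p) p = contradiction p ¬p

⟦⟧-false : ∀ {p} {P : Set p} (P? : Dec P) → ¬ P → ⟦ P? ⟧ ≡ 0
⟦⟧-false (yes p) ¬p = contradiction p ¬p
⟦⟧-false (no _)  _  = refl

⟦⟧≤ : ∀ {p} {P : Set p} (P? : Dec P) {n} → (P → 1 ≤ n) → ⟦ P? ⟧ ≤ n
⟦⟧≤ (yes p) h = h p
⟦⟧≤ (no _)  _ = z≤n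

⟦⟧*≤ : ∀ {p} {P : Set p} (P? : Dec P) {a b} → (P → a ≤ b) → ⟦ P? ⟧ * a ≤ b
⟦⟧*≤ (yes p) {a} h = ≤-trans (≤-reflexive (*-identityˡ a)) (h p)
⟦⟧*≤ (no _)  _     = z≤n

⟦⟧≡0 : ∀ {p} {P : Set p} (P? : Dec P) → ⟦ P? ⟧ ≡ 0 → ¬ P
⟦⟧≡0 (no ¬p) _ = ¬p

⟦⟧-cong : ∀ {p q} {P : Set p} {Q : Set q} (P? : Dec P) (Q? : Dec Q) → (P → Q) → (Q → P) → ⟦ P? ⟧ ≡ ⟦ Q? ⟧
⟦⟧-cong (yes p) Q? f g = sym (⟦⟧-true Q? (f p))
⟦⟧-cong (no ¬p) Q? f g = sym (⟦⟧-false Q? (¬p ∘ g))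

∑-mono : ∀ n {f g} → (∀ i → i < n → f i ≤ g i) → ∑ n f ≤ ∑ n g
∑-mono zero    h = z≤n
∑-mono (suc n) h = +-mono-≤ (∑-mono n (λ i i<n → h i (m<n⇒m<1+n i<n))) (h n ≤-refl)

∑-cong : ∀ n {f g} → (∀ i → i < n → f i ≡ g i) → ∑ n f ≡ ∑ n g
∑-cong zero    h = refl
∑-cong (suc n) h = cong₂ _+_ (∑-cong n (λ i i<n → h i (m<n⇒m<1+n i<n))) (h n ≤-refl)

∑-const : ∀ n c → ∑ n (λ _ → c) ≡ n * c
∑-const zero    c = refl
∑-const (suc n) c = trans (cong (_+ c) (∑-const n c)) (+-comm (n * c) c)

∑-0 : ∀ n → ∑ n (λ _ → 0) ≡ 0
∑-0 n = trans (∑-const n 0) (*-zeroʳ n)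

∑-+ : ∀ n f g → ∑ n (λ i → f i + g i) ≡ ∑ n f + ∑ n g
∑-+ zero    f g = refl
∑-+ (suc n) f g rewrite ∑-+ n f g = lemma (∑ n f) (∑ n g) (f n) (g n)
  where lemma : ∀ a b c d → a + b + (c + d) ≡ a + c + (b + d)
        lemma = solve-∀

∑-*ˡ : ∀ n c f → ∑ n (λ i → c * f i) ≡ c * ∑ n f
∑-*ˡ zero    c f = sym (*-zeroʳ c)
∑-*ˡ (suc n) c f rewrite ∑-*ˡ n c f = sym (*-distribˡ-+ c (∑ n f) (f n))

∑-*ʳ : ∀ n c f → ∑ n (λ i → f i * c) ≡ ∑ n f * c
∑-*ʳ n c f = trans (∑-cong n (λ i _ → *-comm (f i) c)) (trans (∑-*ˡ n c f) (*-comm c _))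

∑-swap : ∀ m n (f : ℕ → ℕ → ℕ) → ∑ m (λ i → ∑ n (f i)) ≡ ∑ n (λ j → ∑ m (λ i → f i j))
∑-swap zero    n f = sym (∑-0 n)
∑-swap (suc m) n f rewrite ∑-swap m n f = sym (∑-+ n (λ j → ∑ m (λ i → f i j)) (f m))

∑-product : ∀ m n f g → ∑ m (λ i → ∑ n (λ j → f i * g j)) ≡ ∑ m f * ∑ n g
∑-product m n f g = trans (∑-cong m (λ i _ → ∑-*ˡ n (f i) g)) (∑-*ʳ m (∑ n g) f)

∑-term : ∀ n f {i} → i < n → f i ≤ ∑ n f
∑-term (suc n) f {i} i<1+n with i ≟ n
... | yes refl = m≤n+m (f n) _
... | no i≢n   = ≤-trans (∑-term n f (≤∧≢⇒< (≤-pred i<1+n) i≢n)) (m≤m+n _ _)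

∑-head : ∀ n f → ∑ (suc n) f ≡ f 0 + ∑ n (f ∘ suc)
∑-head zero    f = +-comm 0 (f 0)
∑-head (suc n) f = trans (cong (_+ f (suc n)) (∑-head n f)) (+-assoc (f 0) _ _)

∑-extend : ∀ {m n} f → m ≤ n → (∀ i → m ≤ i → f i ≡ 0) → ∑ n f ≡ ∑ m f
∑-extend {m} {zero}  f z≤n h = refl
∑-extend {m} {suc n} f m≤1+n h with m ≟ suc n
... | yes refl = refl
... | no m≢1+n = begin
  ∑ n f + f n ≡⟨ cong₂ _+_ (∑-extend f m≤n h) (h n m≤n) ⟩
  ∑ m f + 0   ≡⟨ +-identityʳ _ ⟩
  ∑ m f       ∎
  where open ≡-Reasoning
        m≤n : m ≤ n
        m≤n = ≤-pred (≤∧≢⇒< m≤1+n m≢1+n)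

-- Stands in for injectivity when counting: a quantity determined by the data is met at most once
-- when its possible values are summed over.
∑-≟≤1 : ∀ n a → ∑ n (λ i → ⟦ a ≟ i ⟧) ≤ 1
∑-≟≤1 zero    a = z≤n
∑-≟≤1 (suc n) a with a ≟ n
... | yes refl = ≤-reflexive (cong (_+ 1) (trans (∑-cong n (λ i i<n → ⟦⟧-false (n ≟ i) (λ n≡i → <⇒≢ i<n (sym n≡i)))) (∑-0 n)))
... | no _     = ≤-trans (≤-reflexive (+-identityʳ _)) (∑-≟≤1 n a)

∑-≟ : ∀ n {a} → a < n → ∑ n (λ i → ⟦ a ≟ i ⟧) ≡ 1
∑-≟ n {a} a<n = ≤-antisym (∑-≟≤1 n a)
  (≤-trans (≤-reflexive (sym (⟦⟧-true (a ≟ a) refl))) (∑-term n (λ i → ⟦ a ≟ i ⟧) a<n))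

∑<n⇒∃zero : ∀ n f → ∑ n f < n → ∃[ i ] (i < n × f i ≡ 0)
∑<n⇒∃zero (suc n) f lt with f n in eq
... | zero  = n , ≤-refl , eq
... | suc a with ∑<n⇒∃zero n f (≤-trans (s≤s (m≤m+n (∑ n f) a)) (≤-pred (≤-trans (≤-reflexive (cong suc (sym (+-suc (∑ n f) a)))) lt)))
...   | i , i<n , fi≡0 = i , m<n⇒m<1+n i<n , fi≡0

∑≡0 : ∀ n f → ∑ n f ≡ 0 → ∀ {i} → i < n → f i ≡ 0
∑≡0 n f eq i<n = n≤0⇒n≡0 (≤-trans (∑-term n f i<n) (≤-reflexive eq))

-- The divisor function

count-filter : ∀ {P : ℕ → Set} (P? : ∀ k → Dec (P k)) f n →
               length (filter P? (applyUpTo f n)) ≡ ∑ n (λ i → ⟦ P? (f i) ⟧)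
count-filter P? f zero = refl
count-filter P? f (suc n) = trans step (sym (∑-head n _))
  where
  step : length (filter P? (applyUpTo f (suc n))) ≡ ⟦ P? (f 0) ⟧ + ∑ n (λ i → ⟦ P? (f (suc i)) ⟧)
  step with P? (f 0)
  ... | yes _ = cong suc (count-filter P? (f ∘ suc) n)
  ... | no _  = count-filter P? (f ∘ suc) n

d-sum : ∀ {n X} .{{_ : NonZero n}} → n < X → d n ≡ ∑ X (λ k → ⟦ k ∣? n ⟧)
d-sum {suc n-1} {X} n<X = begin
  d n                                  ≡⟨ cong (length ∘ filter (_∣? n)) (map-upTo suc n) ⟩
  length (filter (_∣? n) (applyUpTo suc n)) ≡⟨ count-filter (_∣? n) suc n ⟩
  ∑ n (λ i → ⟦ suc i ∣? n ⟧)           ≡⟨⟩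
  0 + ∑ n (λ i → ⟦ suc i ∣? n ⟧)       ≡⟨ cong (_+ ∑ n (λ i → ⟦ suc i ∣? n ⟧)) (⟦⟧-false (0 ∣? n) λ 0∣n → 1+n≢0 (0∣⇒≡0 0∣n)) ⟨
  ⟦ 0 ∣? n ⟧ + ∑ n (λ i → ⟦ suc i ∣? n ⟧) ≡⟨ ∑-head n (λ k → ⟦ k ∣? n ⟧) ⟨
  ∑ (suc n) (λ k → ⟦ k ∣? n ⟧)         ≡⟨ ∑-extend _ n<X (λ i n<i → ⟦⟧-false (i ∣? n) λ i∣n → ≤⇒≯ (∣⇒≤ i∣n) n<i) ⟨
  ∑ X (λ k → ⟦ k ∣? n ⟧)               ∎
  where open ≡-Reasoning
        n = suc n-1

∣-factor : ∀ {a n X} .{{_ : NonZero n}} → n < X → ⟦ a ∣? n ⟧ ≡ ∑ X (λ b → ⟦ a * b ≟ n ⟧)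
∣-factor {a} {n} {X} n<X with a ∣? n
... | no a∤n = sym (trans (∑-cong X (λ b _ → ⟦⟧-false (a * b ≟ n) λ ab≡n → a∤n (divides b (trans (sym ab≡n) (*-comm a b))))) (∑-0 X))
... | yes (divides q n≡qa) = sym (trans (∑-cong X (λ b _ → ⟦⟧-cong (a * b ≟ n) (q ≟ b) (to b) (from b))) (∑-≟ X (≤-<-trans q≤n n<X)))
  where
  n≡aq : n ≡ a * q
  n≡aq = trans n≡qa (*-comm q a)
  a≢0 : NonZero a
  a≢0 = m*n≢0⇒m≢0 a {{subst NonZero n≡aq (≢-nonZero (≢-nonZero⁻¹ n))}}
  to : ∀ b → a * b ≡ n → q ≡ b
  to b ab≡n = *-cancelˡ-≡ q b a {{a≢0}} (trans (sym n≡aq) (sym ab≡n))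
  from : ∀ b → q ≡ b → a * b ≡ n
  from b refl = sym n≡aq
  q≤n : q ≤ n
  q≤n = ≤-trans (m≤n*m q a {{a≢0}}) (≤-reflexive (sym n≡aq))

d-pairs : ∀ {n X} .{{_ : NonZero n}} → n < X → d n ≡ ∑ X (λ a → ∑ X (λ b → ⟦ a * b ≟ n ⟧))
d-pairs {n} {X} n<X = trans (d-sum n<X) (∑-cong X (λ a _ → ∣-factor n<X))

-- A divisor `e` of `m * n` is determined by the pair `gcd e m`, `e / gcd e m`, whose second entry
-- divides `n`.
d-submult : ∀ m n .{{_ : NonZero m}} .{{_ : NonZero n}} → d (m * n) ≤ d m * d n
d-submult m n = begin
  d (m * n)                                                    ≡⟨ d-sum {X = suc (m * n)} ≤-refl ⟩
  ∑ X (λ e → ⟦ e ∣? m * n ⟧)                                   ≤⟨ ∑-mono X (λ e _ → ⟦⟧≤ (e ∣? m * n) (split e)) ⟩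
  ∑ X (λ e → ∑ m′ (λ a → ∑ n′ (λ b → w a b e)))                ≡⟨ ∑-swap X m′ _ ⟩
  ∑ m′ (λ a → ∑ X (λ e → ∑ n′ (λ b → w a b e)))                ≡⟨ ∑-cong m′ (λ a _ → ∑-swap X n′ _) ⟩
  ∑ m′ (λ a → ∑ n′ (λ b → ∑ X (λ e → w a b e)))                ≤⟨ ∑-mono m′ (λ a _ → ∑-mono n′ (λ b _ → once a b)) ⟩
  ∑ m′ (λ a → ∑ n′ (λ b → ⟦ a ∣? m ⟧ * ⟦ b ∣? n ⟧))            ≡⟨ ∑-product m′ n′ _ _ ⟩
  ∑ m′ (λ a → ⟦ a ∣? m ⟧) * ∑ n′ (λ b → ⟦ b ∣? n ⟧)            ≡⟨ cong₂ _*_ (d-sum ≤-refl) (d-sum ≤-refl) ⟨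
  d m * d n                                                    ∎
  where
  open ≤-Reasoning
  instance _ = m*n≢0 m n
  X = suc (m * n)
  m′ = suc m
  n′ = suc n
  w : ℕ → ℕ → ℕ → ℕ
  w a b e = ⟦ a ∣? m ⟧ * ⟦ b ∣? n ⟧ * ⟦ a * b ≟ e ⟧
  once : ∀ a b → ∑ X (λ e → w a b e) ≤ ⟦ a ∣? m ⟧ * ⟦ b ∣? n ⟧
  once a b = begin
    ∑ X (λ e → w a b e)                                       ≡⟨ ∑-*ˡ X (⟦ a ∣? m ⟧ * ⟦ b ∣? n ⟧) _ ⟩
    ⟦ a ∣? m ⟧ * ⟦ b ∣? n ⟧ * ∑ X (λ e → ⟦ a * b ≟ e ⟧)       ≤⟨ *-monoʳ-≤ (⟦ a ∣? m ⟧ * ⟦ b ∣? n ⟧) (∑-≟≤1 X (a * b)) ⟩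
    ⟦ a ∣? m ⟧ * ⟦ b ∣? n ⟧ * 1                               ≡⟨ *-identityʳ _ ⟩
    ⟦ a ∣? m ⟧ * ⟦ b ∣? n ⟧                                   ∎
  split : ∀ e → e ∣ m * n → 1 ≤ ∑ m′ (λ a → ∑ n′ (λ b → w a b e))
  split e e∣mn = begin
    1                                    ≡⟨ cong₂ _*_ (cong₂ _*_ (⟦⟧-true (a ∣? m) a∣m) (⟦⟧-true (b ∣? n) b∣n)) (⟦⟧-true (a * b ≟ e) ab≡e) ⟨
    w a b e                              ≤⟨ ∑-term n′ (λ b → w a b e) (s≤s (∣⇒≤ b∣n)) ⟩
    ∑ n′ (λ b → w a b e)                 ≤⟨ ∑-term m′ (λ a → ∑ n′ (λ b → w a b e)) (s≤s (∣⇒≤ a∣m)) ⟩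
    ∑ m′ (λ a → ∑ n′ (λ b → w a b e))    ∎
    where
    a = gcd e m
    a∣m = gcd[m,n]∣n e m
    a∣e = gcd[m,n]∣m e m
    instance _ = ≢-nonZero (gcd[m,n]≢0 e m (inj₂ (≢-nonZero⁻¹ m)))
    b = quotient a∣e
    ab≡e : a * b ≡ e
    ab≡e = sym (m∣n⇒n≡m*quotient a∣e)
    -- `a * b = e` divides `e * n` and `m * n`, hence their gcd `a * n`.
    b∣n : b ∣ n
    b∣n = *-cancelˡ-∣ a (subst (_∣ a * n) (sym ab≡e) (∣-trans (gcd-greatest (∣m⇒∣m*n n ∣-refl) e∣mn)
            (∣-reflexive (trans (cong₂ gcd (*-comm e n) (*-comm m n)) (trans (sym (c*gcd[m,n]≡gcd[cm,cn] n e m)) (*-comm n a))))))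

-- For the reverse inequality, the pair `a ∣ m`, `b ∣ n` is recovered from `e = a * b` as `gcd e m`,
-- `gcd e n`.
d-coprime : ∀ m n .{{_ : NonZero m}} .{{_ : NonZero n}} → Coprime m n → d (m * n) ≡ d m * d n
d-coprime m n m⊥n = ≤-antisym (d-submult m n) (begin
  d m * d n                                                    ≡⟨ cong₂ _*_ (d-sum ≤-refl) (d-sum ≤-refl) ⟩
  ∑ m′ (λ a → ⟦ a ∣? m ⟧) * ∑ n′ (λ b → ⟦ b ∣? n ⟧)            ≡⟨ ∑-product m′ n′ _ _ ⟨
  ∑ m′ (λ a → ∑ n′ (λ b → ⟦ a ∣? m ⟧ * ⟦ b ∣? n ⟧))            ≤⟨ ∑-mono m′ (λ a _ → ∑-mono n′ (λ b _ → join a b)) ⟩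
  ∑ m′ (λ a → ∑ n′ (λ b → ∑ X (λ e → w a b e)))                ≡⟨ ∑-cong m′ (λ a _ → ∑-swap X n′ _) ⟨
  ∑ m′ (λ a → ∑ X (λ e → ∑ n′ (λ b → w a b e)))                ≡⟨ ∑-swap X m′ _ ⟨
  ∑ X (λ e → ∑ m′ (λ a → ∑ n′ (λ b → w a b e)))                ≤⟨ ∑-mono X (λ e _ → once e) ⟩
  ∑ X (λ e → ⟦ e ∣? m * n ⟧)                                   ≡⟨ d-sum {X = suc (m * n)} ≤-refl ⟨
  d (m * n)                                                    ∎)
  where
  open ≤-Reasoning
  instance _ = m*n≢0 m n
  X = suc (m * n)
  m′ = suc m
  n′ = suc n
  w : ℕ → ℕ → ℕ → ℕ
  w a b e = ⟦ e ∣? m * n ⟧ * (⟦ gcd e m ≟ a ⟧ * ⟦ gcd e n ≟ b ⟧)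
  once : ∀ e → ∑ m′ (λ a → ∑ n′ (λ b → w a b e)) ≤ ⟦ e ∣? m * n ⟧
  once e = begin
    ∑ m′ (λ a → ∑ n′ (λ b → w a b e))                          ≡⟨ ∑-cong m′ (λ a _ → ∑-*ˡ n′ ⟦ e ∣? m * n ⟧ _) ⟩
    ∑ m′ (λ a → ⟦ e ∣? m * n ⟧ * ∑ n′ (λ b → ⟦ gcd e m ≟ a ⟧ * ⟦ gcd e n ≟ b ⟧)) ≡⟨ ∑-*ˡ m′ ⟦ e ∣? m * n ⟧ _ ⟩
    ⟦ e ∣? m * n ⟧ * ∑ m′ (λ a → ∑ n′ (λ b → ⟦ gcd e m ≟ a ⟧ * ⟦ gcd e n ≟ b ⟧)) ≡⟨ cong (⟦ e ∣? m * n ⟧ *_) (∑-product m′ n′ _ _) ⟩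
    ⟦ e ∣? m * n ⟧ * (∑ m′ (λ a → ⟦ gcd e m ≟ a ⟧) * ∑ n′ (λ b → ⟦ gcd e n ≟ b ⟧)) ≤⟨ *-monoʳ-≤ ⟦ e ∣? m * n ⟧ (*-mono-≤ (∑-≟≤1 m′ (gcd e m)) (∑-≟≤1 n′ (gcd e n))) ⟩
    ⟦ e ∣? m * n ⟧ * 1                                         ≡⟨ *-identityʳ _ ⟩
    ⟦ e ∣? m * n ⟧                                             ∎
  gcd-part : ∀ {a b m n} → Coprime m n → a ∣ m → b ∣ n → gcd (a * b) m ≡ a
  gcd-part {a} {b} {m} {n} m⊥n a∣m b∣n = ∣-antisym
    (coprime-divisor {n = b} (λ {k} (k∣g , k∣b) → m⊥n (∣-trans k∣g (gcd[m,n]∣n (a * b) m) , ∣-trans k∣b b∣n))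
      (subst (gcd (a * b) m ∣_) (*-comm a b) (gcd[m,n]∣m (a * b) m)))
    (gcd-greatest (m∣m*n b) a∣m)
  join : ∀ a b → ⟦ a ∣? m ⟧ * ⟦ b ∣? n ⟧ ≤ ∑ X (λ e → w a b e)
  join a b = ⟦⟧*≤ (a ∣? m) λ a∣m → ⟦⟧≤ (b ∣? n) λ b∣n →
    let ab∣mn = *-pres-∣ a∣m b∣n in begin
    1                   ≡⟨ cong₂ _*_ (⟦⟧-true (a * b ∣? m * n) ab∣mn)
                            (cong₂ _*_ (⟦⟧-true (gcd (a * b) m ≟ a) (gcd-part m⊥n a∣m b∣n))
                                       (⟦⟧-true (gcd (a * b) n ≟ b) (trans (cong (λ k → gcd k n) (*-comm a b)) (gcd-part (coprime-sym m⊥n) b∣n a∣m)))) ⟨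
    w a b (a * b)       ≤⟨ ∑-term X (w a b) (s≤s (∣⇒≤ ab∣mn)) ⟩
    ∑ X (λ e → w a b e) ∎

d-mono-∣ : ∀ {m n} .{{_ : NonZero m}} .{{_ : NonZero n}} → m ∣ n → d m ≤ d n
d-mono-∣ {m} {n} m∣n = begin
  d m                            ≡⟨ d-sum (s≤s (∣⇒≤ m∣n)) ⟩
  ∑ (suc n) (λ k → ⟦ k ∣? m ⟧)   ≤⟨ ∑-mono (suc n) (λ k _ → ⟦⟧≤ (k ∣? m) (λ k∣m → ≤-reflexive (sym (⟦⟧-true (k ∣? n) (∣-trans k∣m m∣n))))) ⟩
  ∑ (suc n) (λ k → ⟦ k ∣? n ⟧)   ≡⟨ d-sum ≤-refl ⟨
  d n                            ∎
  where open ≤-Reasoning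

d≤n : ∀ n .{{_ : NonZero n}} → d n ≤ n
d≤n n = begin
  d n                                      ≡⟨ d-sum ≤-refl ⟩
  ∑ (suc n) (λ k → ⟦ k ∣? n ⟧)             ≡⟨ ∑-head n _ ⟩
  ⟦ 0 ∣? n ⟧ + ∑ n (λ k → ⟦ suc k ∣? n ⟧)  ≡⟨ cong (_+ ∑ n (λ k → ⟦ suc k ∣? n ⟧)) (⟦⟧-false (0 ∣? n) λ 0∣n → ≢-nonZero⁻¹ n (0∣⇒≡0 0∣n)) ⟩
  ∑ n (λ k → ⟦ suc k ∣? n ⟧)               ≤⟨ ∑-mono n (λ k _ → ⟦⟧≤ (suc k ∣? n) (λ _ → ≤-refl)) ⟩
  ∑ n (λ _ → 1)                            ≡⟨ trans (∑-const n 1) (*-identityʳ n) ⟩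
  n                                        ∎
  where open ≤-Reasoning

d-prime≤2 : ∀ {p} → Prime p → d p ≤ 2
d-prime≤2 {p} pr = begin
  d p                                              ≡⟨ d-sum {p} ≤-refl ⟩
  ∑ (suc p) (λ k → ⟦ k ∣? p ⟧)                     ≤⟨ ∑-mono (suc p) (λ k _ → ⟦⟧≤ (k ∣? p) (trivial k)) ⟩
  ∑ (suc p) (λ k → ⟦ 1 ≟ k ⟧ + ⟦ p ≟ k ⟧)          ≡⟨ ∑-+ (suc p) _ _ ⟩
  ∑ (suc p) (λ k → ⟦ 1 ≟ k ⟧) + ∑ (suc p) (λ k → ⟦ p ≟ k ⟧) ≤⟨ +-mono-≤ (∑-≟≤1 (suc p) 1) (∑-≟≤1 (suc p) p) ⟩
  2                                                ∎
  where
  open ≤-Reasoning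
  instance _ = nonTrivial⇒nonZero p {{prime⇒nonTrivial pr}}
  trivial : ∀ k → k ∣ p → 1 ≤ ⟦ 1 ≟ k ⟧ + ⟦ p ≟ k ⟧
  trivial k k∣p with prime⇒irreducible pr k∣p
  ... | inj₁ refl = s≤s z≤n
  ... | inj₂ refl = ≤-trans (≤-reflexive (sym (⟦⟧-true (p ≟ p) refl))) (m≤n+m _ _)

∑-symmetric : ∀ n (f : ℕ → ℕ → ℕ) → (∀ a b → f a b ≡ f b a) →
              ∃[ q ] ∑ n (λ a → ∑ n (f a)) ≡ 2 * q + ∑ n (λ a → f a a)
∑-symmetric zero    f f-sym = 0 , refl
∑-symmetric (suc n) f f-sym with ∑-symmetric n f f-sym
... | q , eq = q + ∑ n (f n) , (begin
  ∑ n (λ a → ∑ n (f a) + f a n) + (∑ n (f n) + f n n)         ≡⟨ cong (_+ (∑ n (f n) + f n n)) (∑-+ n _ _) ⟩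
  ∑ n (λ a → ∑ n (f a)) + ∑ n (λ a → f a n) + (∑ n (f n) + f n n) ≡⟨ cong₂ (λ x y → x + y + (∑ n (f n) + f n n)) eq (∑-cong n (λ a _ → f-sym a n)) ⟩
  2 * q + ∑ n (λ a → f a a) + ∑ n (f n) + (∑ n (f n) + f n n) ≡⟨ lemma q (∑ n (λ a → f a a)) (∑ n (f n)) (f n n) ⟩
  2 * (q + ∑ n (f n)) + (∑ n (λ a → f a a) + f n n)           ∎)
  where
  open ≡-Reasoning
  lemma : ∀ q a b c → 2 * q + a + b + (b + c) ≡ 2 * (q + b) + (a + c)
  lemma = solve-∀

-- Swapping the factors in `a * b = n` is an involution whose fixed points are the square roots of
-- `n`.
d-parity : ∀ n .{{_ : NonZero n}} → ∃[ q ] d n ≡ 2 * q + ∑ (suc n) (λ a → ⟦ a * a ≟ n ⟧)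
d-parity n with ∑-symmetric (suc n) (λ a b → ⟦ a * b ≟ n ⟧) (λ a b → cong (λ k → ⟦ k ≟ n ⟧) (*-comm a b))
... | q , eq = q , trans (d-pairs ≤-refl) eq

d-even : ∀ n .{{_ : NonZero n}} → (∀ a → a * a ≢ n) → 2 ∣ d n
d-even n nonsq with d-parity n
... | q , eq = divides q (trans eq (trans (cong (2 * q +_)
    (trans (∑-cong (suc n) (λ a _ → ⟦⟧-false (a * a ≟ n) (nonsq a))) (∑-0 (suc n)))) (trans (+-identityʳ _) (*-comm 2 q))))

d-square-odd : ∀ s .{{_ : NonZero s}} → ∃[ q ] d (s * s) ≡ 2 * q + 1
d-square-odd s with d-parity (s * s) {{m*n≢0 s s}}
... | q , eq = q , trans eq (cong (2 * q +_) (trans (∑-cong (suc (s * s)) (λ a _ → ⟦⟧-cong (a * a ≟ s * s) (s ≟ a) (root a) λ { refl → refl }))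
                                                    (∑-≟ (suc (s * s)) (s≤s (m≤m*n s s)))))
  where
  root : ∀ a → a * a ≡ s * s → s ≡ a
  root a eq with <-cmp a s
  ... | tri< a<s _ _ = contradiction eq (<⇒≢ (*-mono-< a<s a<s))
  ... | tri≈ _ a≡s _ = sym a≡s
  ... | tri> _ _ s<a = contradiction (sym eq) (<⇒≢ (*-mono-< s<a s<a))

between-squares : ∀ {n z} → z * z < n → n < suc z * suc z → ∀ a → a * a ≢ n
between-squares {n} {z} lo hi a refl with a ≤? z
... | yes a≤z = <⇒≱ lo (*-mono-≤ a≤z a≤z)
... | no a≰z  = <⇒≱ hi (*-mono-≤ (≰⇒> a≰z) (≰⇒> a≰z))

-- Bounding d by its values on small divisors

prime-divisor : ∀ n → 1 < n → ∃[ p ] (Prime p × p ∣ n)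
prime-divisor n@(suc _) 1<n with factorise n
... | record { factors = [] ; isFactorisation = n≡1 } = contradiction (sym n≡1) (<⇒≢ 1<n)
... | record { factors = p ∷ ps ; isFactorisation = n≡p*ps ; factorsPrime = pr ∷ _ } =
  p , pr , subst (p ∣_) (sym n≡p*ps) (m∣m*n _)

-- The bound is `suc T` so that the divisor 1 always qualifies.
greatest-divisor≤ : ∀ n T → ∃[ δ ] (δ ∣ n × δ ≤ suc T × (∀ {e} → e ∣ n → e ≤ suc T → e ≤ δ))
greatest-divisor≤ n zero = 1 , 1∣ n , ≤-refl , λ _ e≤1 → e≤1
greatest-divisor≤ n (suc T) with suc (suc T) ∣? n | greatest-divisor≤ n T
... | yes T∣n | _ = suc (suc T) , T∣n , ≤-refl , λ _ e≤T → e≤T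
... | no T∤n | δ , δ∣n , δ≤T , max = δ , δ∣n , m≤n⇒m≤1+n δ≤T ,
  λ {e} e∣n e≤T → max e∣n (≤-pred (≤∧≢⇒< e≤T λ { refl → T∤n e∣n }))

-- Remove from n its greatest divisor δ ≤ T and one further prime p: since δ p > T,
-- the remaining cofactor is below n / T.
d≤small-divisors : ∀ T {D} r n .{{_ : NonZero n}} → n < suc T ^ r →
                   (∀ δ → δ ∣ n → δ ≤ suc T → d δ ≤ D) → d n ≤ (2 * D) ^ r
d≤small-divisors T {D} zero n n<1 small = contradiction (n<1⇒n≡0 n<1) (≢-nonZero⁻¹ n)
d≤small-divisors T-1 {D} (suc r) n n<T^ small with n ≤? suc T-1
... | yes n≤T = begin
  d n                     ≤⟨ small n ∣-refl n≤T ⟩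
  D                       ≤⟨ m≤n*m D 2 ⟩
  2 * D                   ≡⟨ *-identityʳ _ ⟨
  2 * D * 1               ≤⟨ *-monoʳ-≤ (2 * D) (m^n>0 (2 * D) r) ⟩
  2 * D * (2 * D) ^ r     ∎
  where
  open ≤-Reasoning
  instance _ = >-nonZero {2 * D} (≤-trans (small 1 (1∣ n) (s≤s z≤n)) (m≤n*m D 2))
... | no n≰T with greatest-divisor≤ n T-1
...   | δ , divides n₁ n≡n₁δ , δ≤T , max with prime-divisor n₁ 1<n₁
  where
  1<n₁ : 1 < n₁
  1<n₁ = ≰⇒> λ n₁≤1 → n≰T (≤-trans (≤-reflexive n≡n₁δ) (≤-trans (*-monoˡ-≤ δ n₁≤1) (≤-trans (≤-reflexive (*-identityˡ δ)) δ≤T)))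
...     | p , pr , divides n₂ n₁≡n₂p = begin
  d n                             ≡⟨ cong d n≡ ⟩
  d (δ * (p * n₂))                ≤⟨ d-submult δ (p * n₂) ⟩
  d δ * d (p * n₂)                ≤⟨ *-mono-≤ (small δ δ∣n δ≤T) (d-submult p n₂) ⟩
  D * (d p * d n₂)                ≤⟨ *-monoʳ-≤ D (*-mono-≤ (d-prime≤2 pr) (d≤small-divisors T-1 r n₂ n₂<T^r
                                       (λ e e∣n₂ → small e (∣-trans e∣n₂ n₂∣n)))) ⟩
  D * (2 * (2 * D) ^ r)           ≡⟨ lemma D ((2 * D) ^ r) ⟩
  2 * D * (2 * D) ^ r             ∎
  where
  open ≤-Reasoning
  T = suc T-1
  lemma : ∀ x y → x * (2 * y) ≡ 2 * x * y
  lemma = solve-∀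
  lemma′ : ∀ δ p n₂ → n₂ * p * δ ≡ δ * (p * n₂)
  lemma′ = solve-∀
  n≡ : n ≡ δ * (p * n₂)
  n≡ = trans n≡n₁δ (trans (cong (_* δ) n₁≡n₂p) (lemma′ δ p n₂))
  n≢0 : NonZero (δ * (p * n₂))
  n≢0 = subst NonZero n≡ (≢-nonZero (≢-nonZero⁻¹ n))
  instance
    δ≢0 = m*n≢0⇒m≢0 δ {{n≢0}}
    pn₂≢0 = m*n≢0⇒n≢0 δ {p * n₂} {{n≢0}}
  instance
    p≢0 = m*n≢0⇒m≢0 p {{pn₂≢0}}
    n₂≢0 = m*n≢0⇒n≢0 p {n₂} {{pn₂≢0}}
  δ∣n : δ ∣ n
  δ∣n = divides n₁ n≡n₁δ
  n₂∣n : n₂ ∣ n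
  n₂∣n = subst (n₂ ∣_) (sym n≡) (∣n⇒∣m*n δ (n∣m*n p))
  δp∣n : δ * p ∣ n
  δp∣n = divides n₂ (trans n≡ (trans (sym (*-assoc δ p n₂)) (*-comm (δ * p) n₂)))
  T<δp : T < δ * p
  T<δp = ≰⇒> λ δp≤T → <⇒≱ (m<m*n δ p (nonTrivial⇒n>1 p {{prime⇒nonTrivial pr}})) (max δp∣n δp≤T)
  n₂<T^r : n₂ < T ^ r
  n₂<T^r = *-cancelˡ-< T n₂ (T ^ r) (begin-strict
    T * n₂          <⟨ *-monoˡ-< n₂ T<δp ⟩
    δ * p * n₂      ≡⟨ trans n≡ (sym (*-assoc δ p n₂)) ⟨
    n               <⟨ n<T^ ⟩
    T * T ^ r       ∎)

-- Reciprocal sums weighted by the divisor function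

∑-split : ∀ m n f → ∑ (m + n) f ≡ ∑ m f + ∑ n (λ i → f (m + i))
∑-split m zero    f = trans (cong (λ k → ∑ k f) (+-identityʳ m)) (sym (+-identityʳ _))
∑-split m (suc n) f rewrite +-suc m n = trans (cong (_+ f (m + n)) (∑-split m n f)) (+-assoc (∑ m f) _ _)

-- weight T n = T! / n for 1 ≤ n ≤ T, a reciprocal cleared of denominators.
weight : ℕ → ℕ → ℕ
weight T zero    = 0
weight T (suc n) = T ! / suc n

weight-spec : ∀ {T n} .{{_ : NonZero n}} → n ≤ T → n * weight T n ≡ T !
weight-spec {T} {suc n} n<T = m*[n/m]≡n (∣-trans (m∣m*n (n !)) (m≤n⇒m!∣n! n<T))

weight-mult : ∀ {T} a b .{{_ : NonZero (a * b)}} → a * b ≤ T → T ! * weight T (a * b) ≡ weight T a * weight T b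
weight-mult {T} a b ab≤T = *-cancelˡ-≡ _ _ (a * b) (begin
  a * b * (T ! * weight T (a * b))         ≡⟨ lemma (a * b) (T !) (weight T (a * b)) ⟩
  T ! * (a * b * weight T (a * b))         ≡⟨ cong (T ! *_) (weight-spec {n = a * b} ab≤T) ⟩
  T ! * T !                                ≡⟨ cong₂ _*_ (weight-spec a≤T) (weight-spec b≤T) ⟨
  a * weight T a * (b * weight T b)        ≡⟨ lemma′ a (weight T a) b (weight T b) ⟩
  a * b * (weight T a * weight T b)        ∎)
  where
  open ≡-Reasoning
  instance
    _ = m*n≢0⇒m≢0 a {b}
    _ = m*n≢0⇒n≢0 a {b}
  a≤T : a ≤ T
  a≤T = ≤-trans (m≤m*n a b) ab≤T
  b≤T : b ≤ T
  b≤T = ≤-trans (m≤n*m b a) ab≤T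
  lemma : ∀ x y z → x * (y * z) ≡ y * (x * z)
  lemma = solve-∀
  lemma′ : ∀ x y z w → x * y * (z * w) ≡ x * z * (y * w)
  lemma′ = solve-∀

-- `d n` counts the pairs `a * b = n`; for each of them `g n ≤ g a * g b` and `1/n = (1/a)(1/b)`.
-- Dropping the constraint `a * b ≤ T` leaves a product of two sums. The extra `T !` balances the
-- two weights on the right against the single one on the left.
∑-dirichlet : ∀ T (g : ℕ → ℕ) → (∀ a b .{{_ : NonZero a}} .{{_ : NonZero b}} → g (a * b) ≤ g a * g b) →
  T ! * ∑ (suc T) (λ n → d n * g n * weight T n) ≤ ∑ (suc T) (λ n → g n * weight T n) * ∑ (suc T) (λ n → g n * weight T n)
∑-dirichlet T g g-submult = begin
  T ! * ∑ X (λ n → d n * g n * w n)                             ≡⟨ ∑-*ˡ X (T !) _ ⟨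
  ∑ X (λ n → T ! * (d n * g n * w n))                           ≤⟨ ∑-mono X expand ⟩
  ∑ X (λ n → ∑ X (λ a → ∑ X (λ b → ⟦ a * b ≟ n ⟧ * (h a * h b)))) ≡⟨ ∑-swap X X _ ⟩
  ∑ X (λ a → ∑ X (λ n → ∑ X (λ b → ⟦ a * b ≟ n ⟧ * (h a * h b)))) ≡⟨ ∑-cong X (λ a _ → ∑-swap X X _) ⟩
  ∑ X (λ a → ∑ X (λ b → ∑ X (λ n → ⟦ a * b ≟ n ⟧ * (h a * h b)))) ≤⟨ ∑-mono X (λ a _ → ∑-mono X (λ b _ → once a b)) ⟩
  ∑ X (λ a → ∑ X (λ b → h a * h b))                             ≡⟨ ∑-product X X h h ⟩
  ∑ X h * ∑ X h                                                 ∎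
  where
  open ≤-Reasoning
  X = suc T
  w = weight T
  h : ℕ → ℕ
  h n = g n * w n
  once : ∀ a b → ∑ X (λ n → ⟦ a * b ≟ n ⟧ * (h a * h b)) ≤ h a * h b
  once a b = begin
    ∑ X (λ n → ⟦ a * b ≟ n ⟧ * (h a * h b))  ≡⟨ ∑-*ʳ X (h a * h b) _ ⟩
    ∑ X (λ n → ⟦ a * b ≟ n ⟧) * (h a * h b)  ≤⟨ *-monoˡ-≤ (h a * h b) (∑-≟≤1 X (a * b)) ⟩
    1 * (h a * h b)                          ≡⟨ *-identityˡ _ ⟩
    h a * h b                                ∎
  lemma : ∀ t x y z → t * (x * y * z) ≡ x * (t * (y * z))
  lemma = solve-∀
  lemma′ : ∀ t x y → t * (x * y) ≡ x * (t * y)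
  lemma′ = solve-∀
  lemma″ : ∀ x y z w → x * y * (z * w) ≡ x * z * (y * w)
  lemma″ = solve-∀
  term : ∀ n → NonZero n → n < X → ∀ a b → ⟦ a * b ≟ n ⟧ * (T ! * (g n * w n)) ≤ ⟦ a * b ≟ n ⟧ * (h a * h b)
  term n n≢0 n<X a b with a * b ≟ n
  ... | no _ = z≤n
  ... | yes refl = *-monoʳ-≤ 1 (begin
    T ! * (g (a * b) * w (a * b))    ≡⟨ lemma′ (T !) (g (a * b)) (w (a * b)) ⟩
    g (a * b) * (T ! * w (a * b))    ≡⟨ cong (g (a * b) *_) (weight-mult a b {{n≢0}} (≤-pred n<X)) ⟩
    g (a * b) * (w a * w b)          ≤⟨ *-monoˡ-≤ (w a * w b) (g-submult a b {{m*n≢0⇒m≢0 a {{n≢0}}}} {{m*n≢0⇒n≢0 a {b} {{n≢0}}}}) ⟩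
    g a * g b * (w a * w b)          ≡⟨ lemma″ (g a) (g b) (w a) (w b) ⟩
    h a * h b                        ∎)
  expand : ∀ n → n < X → T ! * (d n * g n * w n) ≤ ∑ X (λ a → ∑ X (λ b → ⟦ a * b ≟ n ⟧ * (h a * h b)))
  expand zero _ = ≤-trans (≤-reflexive (*-zeroʳ (T !))) z≤n
  expand n@(suc _) n<X = begin
    T ! * (d n * g n * w n)                                       ≡⟨ lemma (T !) (d n) (g n) (w n) ⟩
    d n * c                                                       ≡⟨ cong (_* c) (d-pairs n<X) ⟩
    ∑ X (λ a → ∑ X (λ b → ⟦ a * b ≟ n ⟧)) * c                     ≡⟨ ∑-*ʳ X c _ ⟨
    ∑ X (λ a → ∑ X (λ b → ⟦ a * b ≟ n ⟧) * c)                     ≡⟨ ∑-cong X (λ a _ → ∑-*ʳ X c _) ⟨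
    ∑ X (λ a → ∑ X (λ b → ⟦ a * b ≟ n ⟧ * c))                     ≤⟨ ∑-mono X (λ a _ → ∑-mono X (λ b _ → term n _ n<X a b)) ⟩
    ∑ X (λ a → ∑ X (λ b → ⟦ a * b ≟ n ⟧ * (h a * h b)))           ∎
    where c = T ! * (g n * w n)

-- Each dyadic block from `2^h + 1` to `2^(h+1)` has reciprocal sum at most 1. `T` stays fixed
-- during the induction because it sets the common denominator.
harmonic : ∀ T h → 2 ^ h ≤ T → ∑ (suc (2 ^ h)) (weight T) ≤ T ! * suc h
harmonic T zero 1≤T = ≤-reflexive (trans (sym (*-identityˡ _)) (trans (weight-spec 1≤T) (sym (*-identityʳ _))))
harmonic T (suc h) 2^h+1≤T = begin
  ∑ (suc (2 * H)) w                               ≡⟨ cong (λ k → ∑ (suc (H + k)) w) (+-identityʳ H) ⟩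
  ∑ (suc H + H) w                                 ≡⟨ ∑-split (suc H) H w ⟩
  ∑ (suc H) w + ∑ H (λ i → w (suc H + i))         ≤⟨ +-mono-≤ (harmonic T h (≤-trans (m≤n*m H 2) 2^h+1≤T)) (*-cancelˡ-≤ H {{m^n≢0 2 h}} upper) ⟩
  T ! * suc h + T !                               ≡⟨ trans (+-comm _ (T !)) (sym (*-suc (T !) (suc h))) ⟩
  T ! * suc (suc h)                               ∎
  where
  open ≤-Reasoning
  H = 2 ^ h
  w = weight T
  upper : H * ∑ H (λ i → w (suc H + i)) ≤ H * T !
  upper = begin
    H * ∑ H (λ i → w (suc H + i))       ≡⟨ ∑-*ˡ H H _ ⟨
    ∑ H (λ i → H * w (suc H + i))       ≤⟨ ∑-mono H (λ i i<H → begin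
        H * w (suc H + i)               ≤⟨ *-monoˡ-≤ (w (suc H + i)) (m≤n⇒m≤1+n (m≤m+n H i)) ⟩
        (suc H + i) * w (suc H + i)     ≡⟨ weight-spec {T} {suc H + i} (≤-trans (≤-trans (≤-reflexive (sym (+-suc H i))) (+-monoʳ-≤ H (≤-trans i<H (≤-reflexive (sym (+-identityʳ H)))))) 2^h+1≤T) ⟩
        T !                             ∎) ⟩
    ∑ H (λ i → T !)                     ≡⟨ ∑-const H (T !) ⟩
    H * T !                             ∎

-- `∑-dirichlet` squares the bound at each use: with `g = 1` the harmonic bound `h + 1` becomes
-- `(h + 1)²` for `d`, and with `g = d` this becomes `(h + 1)⁴` for `d²`.
∑d²-weight : ∀ h → let T = 2 ^ h in ∑ (suc T) (λ n → d n * d n * weight T n) ≤ T ! * suc h ^ 4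
∑d²-weight h = *-cancelˡ-≤ (T !) (begin
  T ! * ∑ X (λ n → d n * d n * w n)                ≤⟨ ∑-dirichlet T d d-submult ⟩
  ∑ X (λ n → d n * w n) * ∑ X (λ n → d n * w n)    ≤⟨ *-mono-≤ first first ⟩
  (T ! * (suc h * suc h)) * (T ! * (suc h * suc h)) ≡⟨ lemma (T !) (suc h) ⟩
  T ! * (T ! * suc h ^ 4)                          ∎)
  where
  open ≤-Reasoning
  T = 2 ^ h
  X = suc T
  w = weight T
  instance _ = T !≢0
  lemma : ∀ t x → (t * (x * x)) * (t * (x * x)) ≡ t * (t * (x * (x * (x * (x * 1)))))
  lemma = solve-∀
  lemma′ : ∀ t x → (t * x) * (t * x) ≡ t * (t * (x * x))
  lemma′ = solve-∀
  zeroth : ∑ X (λ n → 1 * w n) ≤ T ! * suc h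
  zeroth = ≤-trans (≤-reflexive (∑-cong X (λ n _ → *-identityˡ _))) (harmonic T h ≤-refl)
  first : ∑ X (λ n → d n * w n) ≤ T ! * (suc h * suc h)
  first = *-cancelˡ-≤ (T !) (begin
    T ! * ∑ X (λ n → d n * w n)                    ≡⟨ cong (T ! *_) (∑-cong X (λ n _ → cong (_* w n) (*-identityʳ (d n)))) ⟨
    T ! * ∑ X (λ n → d n * 1 * w n)                ≤⟨ ∑-dirichlet T (λ _ → 1) (λ _ _ → ≤-refl) ⟩
    ∑ X (λ n → 1 * w n) * ∑ X (λ n → 1 * w n)      ≤⟨ *-mono-≤ zeroth zeroth ⟩
    (T ! * suc h) * (T ! * suc h)                  ≡⟨ lemma′ (T !) (suc h) ⟩
    T ! * (T ! * (suc h * suc h))                  ∎)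

-- Counting roots of a quadratic congruence

least-witness : ∀ {P : ℕ → Set} → (∀ t → Dec (P t)) → ∀ T →
                (∀ t → t < T → ¬ P t) ⊎ (∃[ t₀ ] (P t₀ × (∀ t → t < t₀ → ¬ P t)))
least-witness P? zero = inj₁ λ _ ()
least-witness P? (suc T) with least-witness P? T
... | inj₂ found = inj₂ found
... | inj₁ none with P? T
...   | yes pT = inj₂ (T , pT , none)
...   | no ¬pT = inj₁ λ t t<1+T pt → none t (≤∧≢⇒< (≤-pred t<1+T) λ { refl → ¬pT pt }) pt

module _ {P : ℕ → Set} (P? : ∀ t → Dec (P t)) (δ k : ℕ)
         (gap : ∀ t v → P t → P (t + suc v) → δ ≤ k * suc v) where

  -- Every solution below `T` opens a gap of length at least `δ / k` to the next one, the last gap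
  -- being closed by `u`; these disjoint gaps fit below `u`.
  sparse-count-below : ∀ T u → T ≤ u → P u → δ * ∑ T (λ t → ⟦ P? t ⟧) ≤ k * u
  sparse-count-below zero u _ _ = ≤-trans (≤-reflexive (*-zeroʳ δ)) z≤n
  sparse-count-below (suc T) u T<u pu with P? T
  ... | no _ = ≤-trans (≤-reflexive (cong (δ *_) (+-identityʳ _))) (sparse-count-below T u (<⇒≤ T<u) pu)
  ... | yes pT with m≤n⇒∃[o]m+o≡n T<u
  ...   | v , refl = begin
    δ * (∑ T (λ t → ⟦ P? t ⟧) + 1)       ≡⟨ trans (*-distribˡ-+ δ _ 1) (cong (δ * ∑ T (λ t → ⟦ P? t ⟧) +_) (*-identityʳ δ)) ⟩
    δ * ∑ T (λ t → ⟦ P? t ⟧) + δ         ≤⟨ +-mono-≤ (sparse-count-below T T ≤-refl pT) (gap T v pT (subst P (sym (+-suc T v)) pu)) ⟩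
    k * T + k * suc v                    ≡⟨ *-distribˡ-+ k T (suc v) ⟨
    k * (T + suc v)                      ≡⟨ cong (k *_) (+-suc T v) ⟩
    k * suc (T + v)                      ∎
    where open ≤-Reasoning

  -- Without a closing solution `u`, the last solution has no gap after it and costs one further
  -- `δ`.
  sparse-count : ∀ T → δ * ∑ T (λ t → ⟦ P? t ⟧) ≤ k * T + δ
  sparse-count zero = ≤-trans (≤-reflexive (*-zeroʳ δ)) z≤n
  sparse-count (suc T) with P? T
  ... | no _ = ≤-trans (≤-reflexive (cong (δ *_) (+-identityʳ _))) (≤-trans (sparse-count T) (+-monoˡ-≤ δ (*-monoʳ-≤ k (n≤1+n T))))
  ... | yes pT = begin
    δ * (∑ T (λ t → ⟦ P? t ⟧) + 1)       ≡⟨ trans (*-distribˡ-+ δ _ 1) (cong (δ * ∑ T (λ t → ⟦ P? t ⟧) +_) (*-identityʳ δ)) ⟩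
    δ * ∑ T (λ t → ⟦ P? t ⟧) + δ         ≤⟨ +-monoˡ-≤ δ (≤-trans (sparse-count-below T T ≤-refl pT) (*-monoʳ-≤ k (n≤1+n T))) ⟩
    k * suc T + δ                        ∎
    where open ≤-Reasoning

∣gcd* : ∀ {k} a b c → k ∣ a * c → k ∣ b * c → k ∣ gcd a b * c
∣gcd* {k} a b c k∣ac k∣bc = subst (k ∣_) eq (gcd-greatest (subst (k ∣_) (*-comm a c) k∣ac) (subst (k ∣_) (*-comm b c) k∣bc))
  where eq : gcd (c * a) (c * b) ≡ gcd a b * c
        eq = trans (sym (c*gcd[m,n]≡gcd[cm,cn] c a b)) (*-comm c (gcd a b))

-- Two roots y = y₀ + z and y + e of y² ≡ - i (mod δ) with gcd(z, δ) = gcd(z + e, δ) = g satisfy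
-- g ∣ e and δ/g ∣ e, and gcd(g, δ/g) divides 2y₀ and δ, hence 4i.
root-gap : ∀ {δ i y₀ z e} .{{_ : NonZero δ}} → δ ∣ y₀ * y₀ + i → δ ∣ (y₀ + z) * (y₀ + z) + i →
           δ ∣ (y₀ + (z + e)) * (y₀ + (z + e)) + i → gcd (z + e) δ ≡ gcd z δ → δ ∣ 4 * i * e
root-gap {δ} {i} {y₀} {z} {e} δ∣f₀ δ∣f₁ δ∣f₂ same = ∣-trans δ∣we (*-monoˡ-∣ e w∣4i)
  where
  square-diff : ∀ y z i → (y + z) * (y + z) + i ≡ (y * y + i) + z * (2 * y + z)
  square-diff = solve-∀
  δ∣z⟨⟩ : ∀ {z} → δ ∣ (y₀ + z) * (y₀ + z) + i → δ ∣ z * (2 * y₀ + z)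
  δ∣z⟨⟩ {z} δ∣f = ∣m+n∣m⇒∣n (subst (δ ∣_) (square-diff y₀ z i) δ∣f) δ∣f₀
  g = gcd z δ
  g∣z = gcd[m,n]∣m z δ
  g∣δ = gcd[m,n]∣n z δ
  instance _ = ≢-nonZero (gcd[m,n]≢0 z δ (inj₂ (≢-nonZero⁻¹ δ)))
  h = quotient g∣δ
  gh≡δ : g * h ≡ δ
  gh≡δ = sym (m∣n⇒n≡m*quotient g∣δ)
  -- `δ` divides `z * (2 * y₀ + z)` and trivially `δ * (2 * y₀ + z)`, so `g * h = δ` divides
  -- `g * (2 * y₀ + z)`; then `g` cancels.
  h∣ : ∀ {z} → gcd z δ ≡ g → δ ∣ (y₀ + z) * (y₀ + z) + i → h ∣ 2 * y₀ + z
  h∣ {z} eq δ∣f = *-cancelˡ-∣ g (subst (_∣ g * (2 * y₀ + z)) (sym gh≡δ)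
    (subst (λ a → δ ∣ a * (2 * y₀ + z)) eq (∣gcd* z δ _ (δ∣z⟨⟩ δ∣f) (m∣m*n _))))
  h∣y+z : h ∣ 2 * y₀ + z
  h∣y+z = h∣ refl δ∣f₁
  h∣e : h ∣ e
  h∣e = ∣m+n∣m⇒∣n (subst (h ∣_) (sym (+-assoc (2 * y₀) z e)) (h∣ same δ∣f₂)) h∣y+z
  g∣e : g ∣ e
  g∣e = ∣m+n∣m⇒∣n (subst (_∣ z + e) same (gcd[m,n]∣m (z + e) δ)) g∣z
  w = gcd g h
  δ∣we : δ ∣ w * e
  δ∣we = ∣gcd* g h e (subst (_∣ g * e) gh≡δ (*-monoʳ-∣ g h∣e))
                     (subst (_∣ h * e) (trans (*-comm h g) gh≡δ) (*-monoʳ-∣ h g∣e))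
  w∣g = gcd[m,n]∣m g h
  w∣2y₀ : w ∣ 2 * y₀
  w∣2y₀ = ∣m+n∣m⇒∣n (subst (w ∣_) (+-comm (2 * y₀) z) (∣-trans (gcd[m,n]∣n g h) h∣y+z)) (∣-trans w∣g g∣z)
  quadruple : ∀ y i → 4 * (y * y + i) ≡ 2 * y * (2 * y) + 4 * i
  quadruple = solve-∀
  w∣4i : w ∣ 4 * i
  w∣4i = ∣m+n∣m⇒∣n (subst (w ∣_) (quadruple y₀ i) (∣n⇒∣m*n 4 (∣-trans w∣g (∣-trans g∣δ δ∣f₀)))) (∣m⇒∣m*n (2 * y₀) w∣2y₀)

quad : ℕ → ℕ → ℕ → ℕ → ℕ
quad x₀ M i t = (x₀ + t * M) * (x₀ + t * M) + i

-- Modulo `M` every value `quad x₀ M i t` equals `x₀ * x₀ + i`, so this captures whatever `M` shares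
-- with a divisor of any value.
rootGcd : ℕ → ℕ → ℕ → ℕ
rootGcd x₀ M i = gcd M (x₀ * x₀ + i)

module RootCount (x₀ M i : ℕ) .{{_ : NonZero i}} where

  module _ (δ : ℕ) .{{_ : NonZero δ}} where

    G : ℕ
    G = rootGcd x₀ M i

    gcd∣G : ∀ t → δ ∣ quad x₀ M i t → gcd M δ ∣ G
    gcd∣G t δ∣f = gcd-greatest g∣M (∣m+n∣m⇒∣n (subst (gcd M δ ∣_) (expand x₀ t M i) (∣-trans (gcd[m,n]∣n M δ) δ∣f)) (∣m⇒∣m*n _ g∣M))
      where
      g∣M = gcd[m,n]∣m M δ
      expand : ∀ x t M i → (x + t * M) * (x + t * M) + i ≡ M * (t * (2 * x + t * M)) + (x * x + i)
      expand = solve-∀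

    instance
      G≢0 : NonZero (rootGcd x₀ M i)
      G≢0 = ≢-nonZero (gcd[m,n]≢0 M (x₀ * x₀ + i) (inj₂ λ eq → ≢-nonZero⁻¹ i (m+n≡0⇒n≡0 (x₀ * x₀) eq)))

    k : ℕ
    k = 4 * i * G

    -- `root-gap` makes `δ` divide `4 * i * M * suc v`. Here `M` may be replaced by `gcd M δ`, which
    -- divides `G`.
    root-spacing : ∀ t₀ u v → δ ∣ quad x₀ M i t₀ → δ ∣ quad x₀ M i (t₀ + u) → δ ∣ quad x₀ M i (t₀ + u + suc v) →
                   gcd (M * (u + suc v)) δ ≡ gcd (M * u) δ → δ ≤ k * suc v
    root-spacing t₀ u v h₀ h₁ h₂ same = ∣⇒≤ {{m*n≢0 k (suc v) {{m*n≢0 (4 * i) G {{m*n≢0 4 i}}}}}} (begin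
      δ                       ∣⟨ ∣gcd* M δ (4 * i * suc v) δ∣M* (m∣m*n _) ⟩
      gcd M δ * (4 * i * suc v) ∣⟨ *-monoˡ-∣ (4 * i * suc v) (gcd∣G t₀ h₀) ⟩
      G * (4 * i * suc v)     ≡⟨ shuffle G (4 * i) (suc v) ⟩
      k * suc v               ∎)
      where
      open ∣-Reasoning
      shuffle : ∀ a b c → a * (b * c) ≡ b * a * c
      shuffle = solve-∀
      shuffle′ : ∀ a b c → b * (a * c) ≡ a * (b * c)
      shuffle′ = solve-∀
      move₁ : ∀ x t u M → x + (t + u) * M ≡ x + t * M + M * u
      move₁ = solve-∀
      move₂ : ∀ x t u v M → x + (t + u + v) * M ≡ x + t * M + (M * u + M * v)
      move₂ = solve-∀
      δ∣M* : δ ∣ M * (4 * i * suc v)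
      δ∣M* = subst (δ ∣_) (shuffle′ M (4 * i) (suc v)) (root-gap {y₀ = x₀ + t₀ * M} {z = M * u} h₀
        (subst (λ y → δ ∣ y * y + i) (move₁ x₀ t₀ u M) h₁)
        (subst (λ y → δ ∣ y * y + i) (move₂ x₀ t₀ u (suc v) M) h₂)
        (trans (cong (λ z → gcd z δ) (sym (*-distribˡ-+ M u (suc v)))) same))

    -- Relative to one root `t₀`, the roots `t` are sorted by `g = gcd (M * (t ∸ t₀)) δ`. There are
    -- at most `d δ` classes, and inside a class `root-spacing` applies. The final `δ` of
    -- `sparse-count` is absorbed by `δ ≤ T`, whence the factor 2.
    root-count : ∀ T → δ ≤ T → δ * ∑ T (λ t → ⟦ δ ∣? quad x₀ M i t ⟧) ≤ d δ * (2 * k * T)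
    root-count T δ≤T with least-witness (λ t → δ ∣? quad x₀ M i t) T
    ... | inj₁ none = ≤-trans (≤-reflexive (trans (cong (δ *_) (trans (∑-cong T (λ t t<T → ⟦⟧-false (δ ∣? quad x₀ M i t) (none t t<T))) (∑-0 T))) (*-zeroʳ δ))) z≤n
    ... | inj₂ (t₀ , h₀ , least) = begin
      δ * ∑ T (λ t → ⟦ δ ∣? quad x₀ M i t ⟧)                              ≤⟨ *-monoʳ-≤ δ (∑-mono T (λ t _ → ⟦⟧≤ (δ ∣? quad x₀ M i t) (classify t))) ⟩
      δ * ∑ T (λ t → ∑ X (λ g → ⟦ g ∣? δ ⟧ * ⟦ P? g t ⟧))          ≡⟨ cong (δ *_) (∑-swap T X _) ⟩
      δ * ∑ X (λ g → ∑ T (λ t → ⟦ g ∣? δ ⟧ * ⟦ P? g t ⟧))          ≡⟨ ∑-*ˡ X δ _ ⟨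
      ∑ X (λ g → δ * ∑ T (λ t → ⟦ g ∣? δ ⟧ * ⟦ P? g t ⟧))          ≤⟨ ∑-mono X (λ g _ → class g) ⟩
      ∑ X (λ g → ⟦ g ∣? δ ⟧ * (2 * k * T))                         ≡⟨ ∑-*ʳ X (2 * k * T) _ ⟩
      ∑ X (λ g → ⟦ g ∣? δ ⟧) * (2 * k * T)                         ≡⟨ cong (_* (2 * k * T)) (d-sum ≤-refl) ⟨
      d δ * (2 * k * T)                                            ∎
      where
      open ≤-Reasoning
      X = suc δ
      -- `t₀` is the least root, so the truncated subtraction is a true one at every root.
      P : ℕ → ℕ → Set
      P g t = δ ∣ quad x₀ M i t × gcd (M * (t ∸ t₀)) δ ≡ g
      P? : ∀ g t → Dec (P g t)
      P? g t = (δ ∣? quad x₀ M i t) ×-dec (gcd (M * (t ∸ t₀)) δ ≟ g)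
      classify : ∀ t → δ ∣ quad x₀ M i t → 1 ≤ ∑ X (λ g → ⟦ g ∣? δ ⟧ * ⟦ P? g t ⟧)
      classify t h = begin
        1                                     ≡⟨ cong₂ _*_ (⟦⟧-true (g ∣? δ) g∣δ) (⟦⟧-true (P? g t) (h , refl)) ⟨
        ⟦ g ∣? δ ⟧ * ⟦ P? g t ⟧               ≤⟨ ∑-term X (λ g → ⟦ g ∣? δ ⟧ * ⟦ P? g t ⟧) (s≤s (∣⇒≤ g∣δ)) ⟩
        ∑ X (λ g → ⟦ g ∣? δ ⟧ * ⟦ P? g t ⟧)   ∎
        where g = gcd (M * (t ∸ t₀)) δ
              g∣δ = gcd[m,n]∣n (M * (t ∸ t₀)) δ
      gap : ∀ g t v → P g t → P g (t + suc v) → δ ≤ k * suc v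
      gap g t v (h₁ , eq₁) (h₂ , eq₂) with m≤n⇒∃[o]m+o≡n (≮⇒≥ (λ t<t₀ → least t t<t₀ h₁))
      ... | u , refl = root-spacing t₀ u v h₀ h₁ h₂ (begin-equality
        gcd (M * (u + suc v)) δ                ≡⟨ cong (λ a → gcd (M * a) δ) (trans (cong (_∸ t₀) (+-assoc t₀ u (suc v))) (m+n∸m≡n t₀ _)) ⟨
        gcd (M * (t₀ + u + suc v ∸ t₀)) δ      ≡⟨ trans eq₂ (sym eq₁) ⟩
        gcd (M * (t₀ + u ∸ t₀)) δ              ≡⟨ cong (λ a → gcd (M * a) δ) (m+n∸m≡n t₀ u) ⟩
        gcd (M * u) δ                          ∎)
      class : ∀ g → δ * ∑ T (λ t → ⟦ g ∣? δ ⟧ * ⟦ P? g t ⟧) ≤ ⟦ g ∣? δ ⟧ * (2 * k * T)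
      class g = begin
        δ * ∑ T (λ t → ⟦ g ∣? δ ⟧ * ⟦ P? g t ⟧)      ≡⟨ cong (δ *_) (∑-*ˡ T ⟦ g ∣? δ ⟧ _) ⟩
        δ * (⟦ g ∣? δ ⟧ * ∑ T (λ t → ⟦ P? g t ⟧))    ≡⟨ swap δ ⟦ g ∣? δ ⟧ _ ⟩
        ⟦ g ∣? δ ⟧ * (δ * ∑ T (λ t → ⟦ P? g t ⟧))    ≤⟨ *-monoʳ-≤ ⟦ g ∣? δ ⟧ (begin
          δ * ∑ T (λ t → ⟦ P? g t ⟧)                 ≤⟨ sparse-count (P? g) δ k (gap g) T ⟩
          k * T + δ                                  ≤⟨ +-monoʳ-≤ (k * T) (≤-trans δ≤T (m≤n*m T k {{m*n≢0 (4 * i) G {{m*n≢0 4 i}}}})) ⟩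
          k * T + k * T                              ≡⟨ double k T ⟩
          2 * k * T                                  ∎) ⟩
        ⟦ g ∣? δ ⟧ * (2 * k * T)                     ∎
        where
        swap : ∀ a b c → a * (b * c) ≡ b * (a * c)
        swap = solve-∀
        double : ∀ k T → k * T + k * T ≡ 2 * k * T
        double = solve-∀

-- Averaging over the progression

large-divisors : ℕ → ℕ → ℕ → ℕ
large-divisors T Y n = ∑ (suc T) (λ δ → ⟦ Y <? d δ ⟧ * ⟦ δ ∣? n ⟧)

large-divisors≡0 : ∀ {T Y n} → large-divisors T Y n ≡ 0 → ∀ δ → δ ∣ n → δ ≤ T → d δ ≤ Y
large-divisors≡0 {T} {Y} {n} eq δ δ∣n δ≤T = ≮⇒≥ (⟦⟧≡0 (Y <? d δ) (trans (sym (*-identityʳ _))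
  (trans (cong (⟦ Y <? d δ ⟧ *_) (sym (⟦⟧-true (δ ∣? n) δ∣n))) (∑≡0 (suc T) _ eq (s≤s δ≤T)))))

module Averaging (x₀ M h : ℕ) where

  T : ℕ
  T = 2 ^ h

  rate : ℕ → ℕ
  rate i = 2 * (4 * i * rootGcd x₀ M i)

  -- A counted `δ` has `Y < d δ`, so the factor `Y` is paid by one `d δ`. `root-count` supplies a
  -- second `d δ` and a `1/δ`, which is the sum bounded in `∑d²-weight`.
  markov : ∀ i .{{_ : NonZero i}} Y → Y * ∑ T (λ t → large-divisors T Y (quad x₀ M i t)) ≤ suc h ^ 4 * (rate i * T)
  markov i Y = *-cancelˡ-≤ (T !) {{T !≢0}} (begin
    T ! * (Y * ∑ T (λ t → large-divisors T Y (q t)))                    ≡⟨ *-assoc (T !) Y _ ⟨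
    T ! * Y * ∑ T (λ t → ∑ X (λ δ → ⟦ Y <? d δ ⟧ * ⟦ δ ∣? q t ⟧))       ≡⟨ cong (T ! * Y *_) (∑-swap T X _) ⟩
    T ! * Y * ∑ X (λ δ → ∑ T (λ t → ⟦ Y <? d δ ⟧ * ⟦ δ ∣? q t ⟧))       ≡⟨ ∑-*ˡ X (T ! * Y) _ ⟨
    ∑ X (λ δ → T ! * Y * ∑ T (λ t → ⟦ Y <? d δ ⟧ * ⟦ δ ∣? q t ⟧))       ≤⟨ ∑-mono X term ⟩
    ∑ X (λ δ → d δ * d δ * weight T δ * (rate i * T))                   ≡⟨ ∑-*ʳ X (rate i * T) _ ⟩
    ∑ X (λ δ → d δ * d δ * weight T δ) * (rate i * T)                   ≤⟨ *-monoˡ-≤ (rate i * T) (∑d²-weight h) ⟩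
    T ! * suc h ^ 4 * (rate i * T)                                      ≡⟨ *-assoc (T !) _ _ ⟩
    T ! * (suc h ^ 4 * (rate i * T))                                    ∎)
    where
    open ≤-Reasoning
    X = suc T
    q = quad x₀ M i
    rearrange : ∀ t y a s → t * y * (a * s) ≡ a * y * (t * s)
    rearrange = solve-∀
    rearrange′ : ∀ e w s → e * w * s ≡ w * (e * s)
    rearrange′ = solve-∀
    rearrange″ : ∀ a b w c → a * (w * (b * c)) ≡ a * b * w * c
    rearrange″ = solve-∀
    term : ∀ δ → δ < X → T ! * Y * ∑ T (λ t → ⟦ Y <? d δ ⟧ * ⟦ δ ∣? q t ⟧) ≤ d δ * d δ * weight T δ * (rate i * T)
    term zero _ = ≤-reflexive (trans (cong (T ! * Y *_) (trans (∑-cong T λ t _ → trans (cong (⟦ Y <? d 0 ⟧ *_)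
      (⟦⟧-false (0 ∣? q t) λ 0∣q → ≢-nonZero⁻¹ i (m+n≡0⇒n≡0 ((x₀ + t * M) * (x₀ + t * M)) (0∣⇒≡0 0∣q)))) (*-zeroʳ ⟦ Y <? d 0 ⟧)) (∑-0 T))) (*-zeroʳ (T ! * Y)))
    term δ@(suc _) δ<X = begin
      T ! * Y * ∑ T (λ t → ⟦ Y <? d δ ⟧ * ⟦ δ ∣? q t ⟧)     ≡⟨ cong (T ! * Y *_) (∑-*ˡ T ⟦ Y <? d δ ⟧ _) ⟩
      T ! * Y * (⟦ Y <? d δ ⟧ * S)                          ≡⟨ rearrange (T !) Y ⟦ Y <? d δ ⟧ S ⟩
      ⟦ Y <? d δ ⟧ * Y * (T ! * S)                          ≤⟨ *-mono-≤ (⟦⟧*≤ (Y <? d δ) <⇒≤) (begin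
        T ! * S                                             ≡⟨ cong (_* S) (weight-spec {T} {δ} (≤-pred δ<X)) ⟨
        δ * weight T δ * S                                  ≡⟨ rearrange′ δ (weight T δ) S ⟩
        weight T δ * (δ * S)                                ≤⟨ *-monoʳ-≤ (weight T δ) (RootCount.root-count x₀ M i δ T (≤-pred δ<X)) ⟩
        weight T δ * (d δ * (rate i * T))                   ∎) ⟩
      d δ * (weight T δ * (d δ * (rate i * T)))             ≡⟨ rearrange″ (d δ) (d δ) (weight T δ) (rate i * T) ⟩
      d δ * d δ * weight T δ * (rate i * T)                 ∎
      where S = ∑ T (λ t → ⟦ δ ∣? q t ⟧)

  -- By `markov` and `large`, each `i` contributes at most `T / (J + 1)` to the total number of
  -- large divisors over all `t`. With `J` indices the total is below `T`, so some `t` has none.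
  exists-good : ∀ K J (Y : ℕ → ℕ) → (∀ i → NonZero (Y i)) → (∀ i → K < i → i < J → suc J * (suc h ^ 4 * rate i) ≤ Y i) →
                ∃[ t ] (t < T × (∀ i → K < i → i < J → ∀ δ → δ ∣ quad x₀ M i t → δ ≤ T → d δ ≤ Y i))
  exists-good K J Y Y≢0 large = proj₁ good , proj₁ (proj₂ good) ,
    λ i K<i i<J → large-divisors≡0 (m*n≡0∧m≡1 (⟦⟧-true (K <? i) K<i) (∑≡0 J (B (proj₁ good)) (proj₂ (proj₂ good)) i<J))
    where
    open ≤-Reasoning
    B : ℕ → ℕ → ℕ
    B t i = ⟦ K <? i ⟧ * large-divisors T (Y i) (quad x₀ M i t)
    bad : ℕ → ℕ
    bad t = ∑ J (B t)
    rearrange : ∀ y j s → y * (j * s) ≡ j * (y * s)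
    rearrange = solve-∀
    rearrange′ : ∀ j a r t → j * (a * (r * t)) ≡ j * (a * r) * t
    rearrange′ = solve-∀
    each : ∀ i → i < J → suc J * ∑ T (λ t → B t i) ≤ T
    each i i<J = begin
      suc J * ∑ T (λ t → B t i)                ≡⟨ cong (suc J *_) (∑-*ˡ T ⟦ K <? i ⟧ _) ⟩
      suc J * (⟦ K <? i ⟧ * S)                 ≡⟨ rearrange (suc J) ⟦ K <? i ⟧ S ⟩
      ⟦ K <? i ⟧ * (suc J * S)                 ≤⟨ ⟦⟧*≤ (K <? i) (λ K<i → *-cancelˡ-≤ (Y i) {{Y≢0 i}} (begin
        Y i * (suc J * S)                      ≡⟨ rearrange (Y i) (suc J) S ⟩
        suc J * (Y i * S)                      ≤⟨ *-monoʳ-≤ (suc J) (markov i {{>-nonZero (≤-<-trans z≤n K<i)}} (Y i)) ⟩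
        suc J * (suc h ^ 4 * (rate i * T))     ≡⟨ rearrange′ (suc J) (suc h ^ 4) (rate i) T ⟩
        suc J * (suc h ^ 4 * rate i) * T       ≤⟨ *-monoˡ-≤ T (large i K<i i<J) ⟩
        Y i * T                                ∎)) ⟩
      T                                        ∎
      where S = ∑ T (λ t → large-divisors T (Y i) (quad x₀ M i t))
    few : suc J * ∑ T bad < suc J * T
    few = begin-strict
      suc J * ∑ T bad                          ≡⟨ cong (suc J *_) (∑-swap T J B) ⟩
      suc J * ∑ J (λ i → ∑ T (λ t → B t i))    ≡⟨ ∑-*ˡ J (suc J) _ ⟨
      ∑ J (λ i → suc J * ∑ T (λ t → B t i))    ≤⟨ ∑-mono J each ⟩
      ∑ J (λ _ → T)                            ≡⟨ ∑-const J T ⟩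
      J * T                                    <⟨ m<n+m (J * T) {T} (m^n>0 2 h) ⟩
      suc J * T                                ∎
    good : ∃[ t ] (t < T × bad t ≡ 0)
    good = ∑<n⇒∃zero T bad (*-cancelˡ-< (suc J) (∑ T bad) T few)
    m*n≡0∧m≡1 : ∀ {a b} → a ≡ 1 → a * b ≡ 0 → b ≡ 0
    m*n≡0∧m≡1 {b = b} refl eq = trans (sym (*-identityˡ b)) eq

-- Reading off the digits

/-unique : ∀ {m q r n} .{{_ : NonZero n}} → m ≡ q * n + r → r < n → m / n ≡ q
/-unique {q = q} {r} {n} refl r<n = begin
  (q * n + r) / n       ≡⟨ +-distrib-/-∣ˡ r (n∣m*n q) ⟩
  q * n / n + r / n     ≡⟨ cong₂ _+_ (m*n/n≡m q n) (m<n⇒m/n≡0 r<n) ⟩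
  q + 0                 ≡⟨ +-identityʳ q ⟩
  q                     ∎
  where open ≡-Reasoning

^-distribʳ-* : ∀ n a b → (a * b) ^ n ≡ a ^ n * b ^ n
^-distribʳ-* zero    a b = refl
^-distribʳ-* (suc n) a b = trans (cong (a * b *_) (^-distribʳ-* n a b)) (lemma a b (a ^ n) (b ^ n))
  where lemma : ∀ a b x y → a * b * (x * y) ≡ a * x * (b * y)
        lemma = solve-∀

-- The term `d (P + i)` enters `A (P + r)` with factor `2^(r-i)`, so divisibility by `2^(2+i)` turns
-- it into a multiple of `4 * 2^r`: the block changes the integer part only by multiples of 4 and
-- leaves no fraction.
A-block : ∀ P K → (∀ i → 1 ≤ i → i ≤ K → 2 ^ (2 + i) ∣ d (P + i)) → ∀ r → r ≤ K → ∃[ q ] A (P + r) ≡ (A P + 4 * q) * 2 ^ r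
A-block P K div zero _ = 0 , trans (cong A (+-identityʳ P)) (lemma (A P))
  where lemma : ∀ a → a ≡ (a + 0) * 1
        lemma = solve-∀
A-block P K div (suc r) r<K with A-block P K div r (<⇒≤ r<K) | div (suc r) (s≤s z≤n) r<K
... | q , eq | divides w eq′ = q + w , (begin
  A (P + suc r)                                    ≡⟨ cong A (+-suc P r) ⟩
  2 * A (P + r) + d (suc (P + r))                  ≡⟨ cong₂ (λ x y → 2 * x + y) eq (trans (cong d (sym (+-suc P r))) eq′) ⟩
  2 * ((A P + 4 * q) * 2 ^ r) + w * (2 * (2 * (2 * 2 ^ r))) ≡⟨ lemma (A P) q w (2 ^ r) ⟩
  (A P + 4 * (q + w)) * (2 * 2 ^ r)                ∎)
  where
  open ≡-Reasoning
  lemma : ∀ a q w x → 2 * ((a + 4 * q) * x) + w * (2 * (2 * (2 * x))) ≡ (a + 4 * (q + w)) * (2 * x)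
  lemma = solve-∀

-- Starts the invariant of `A-tail`; the exponent 4 is the least one that works, which is the origin
-- of `4 ≤ K`.
3^≤4^ : ∀ r → 3 * 3 ^ (4 + r) ≤ 4 ^ (4 + r)
3^≤4^ zero    = ≤ᵇ⇒≤ 243 256 _
3^≤4^ (suc r) = begin
  3 * (3 * 3 ^ (4 + r)) ≤⟨ *-mono-≤ (n≤1+n 3) (3^≤4^ r) ⟩
  4 * 4 ^ (4 + r)       ∎
  where open ≤-Reasoning

-- Squaring both sides reduces this to `8^i ≤ 9^i`.
sq≤2^⇒≤3^ : ∀ {a i} → a * a ≤ 2 ^ i → 2 ^ i * a ≤ 3 ^ i
sq≤2^⇒≤3^ {a} {i} aa≤ = ≮⇒≥ λ lt → <⇒≱ (*-mono-< lt lt) (begin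
  2 ^ i * a * (2 ^ i * a)       ≡⟨ lemma (2 ^ i) a ⟩
  2 ^ i * 2 ^ i * (a * a)       ≤⟨ *-monoʳ-≤ (2 ^ i * 2 ^ i) aa≤ ⟩
  2 ^ i * 2 ^ i * 2 ^ i         ≡⟨ trans (^-distribʳ-* i 4 2) (cong (_* 2 ^ i) (^-distribʳ-* i 2 2)) ⟨
  8 ^ i                         ≤⟨ ^-monoˡ-≤ i (n≤1+n 8) ⟩
  9 ^ i                         ≡⟨ ^-distribʳ-* i 3 3 ⟩
  3 ^ i * 3 ^ i                 ∎)
  where
  open ≤-Reasoning
  lemma : ∀ x a → x * a * (x * a) ≡ x * x * (a * a)
  lemma = solve-∀

-- The remainder term is kept below 2^r by the invariant 2^r u + 3·3^r ≤ 4^r, since a tail term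
-- is at most (3/2)^i.
A-tail : ∀ P K a → 4 ≤ K → A (P + K) ≡ a * 2 ^ K → (∀ i → K < i → d (P + i) * d (P + i) ≤ 2 ^ i) →
         ∀ r → ∃[ u ] (A (P + (K + r)) ≡ a * 2 ^ (K + r) + u × 2 ^ (K + r) * u + 3 * 3 ^ (K + r) ≤ 4 ^ (K + r))
A-tail P K a 4≤K eq small zero with m≤n⇒∃[o]m+o≡n 4≤K
... | k , refl = 0 , trans (cong (λ j → A (P + j)) (+-identityʳ K)) (trans eq (trans (cong (λ j → a * 2 ^ j) (sym (+-identityʳ K))) (sym (+-identityʳ _)))) ,
  ≤-trans (≤-reflexive (trans (cong (_+ 3 * 3 ^ (K + 0)) (*-zeroʳ (2 ^ (K + 0)))) (cong (λ j → 3 * 3 ^ j) (+-identityʳ K))))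
          (≤-trans (3^≤4^ k) (≤-reflexive (cong (4 ^_) (sym (+-identityʳ K)))))
A-tail P K a 4≤K eq small (suc r) with A-tail P K a 4≤K eq small r
... | u , eq′ , inv = 2 * u + c , (begin
    A (P + (K + suc r))                  ≡⟨ cong (λ j → A (P + j)) (+-suc K r) ⟩
    A (P + suc s)                        ≡⟨ cong A (+-suc P s) ⟩
    2 * A (P + s) + d (suc (P + s))      ≡⟨ cong₂ (λ x y → 2 * x + d y) eq′ (sym (+-suc P s)) ⟩
    2 * (a * 2 ^ s + u) + c              ≡⟨ lemma a (2 ^ s) u c ⟩
    a * 2 ^ suc s + (2 * u + c)          ≡⟨ cong (λ j → a * 2 ^ j + (2 * u + c)) (+-suc K r) ⟨
    a * 2 ^ (K + suc r) + (2 * u + c)    ∎) ,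
  subst (λ j → 2 ^ j * (2 * u + c) + 3 * 3 ^ j ≤ 4 ^ j) (sym (+-suc K r)) (R.begin
    2 ^ suc s * (2 * u + c) + 3 * 3 ^ suc s            R.≡⟨ lemma′ (2 ^ s) u c (3 ^ suc s) ⟩
    4 * (2 ^ s * u) + (2 ^ suc s * c + 3 * 3 ^ suc s)  R.≤⟨ +-monoʳ-≤ (4 * (2 ^ s * u)) (+-monoˡ-≤ (3 * 3 ^ suc s) (sq≤2^⇒≤3^ {c} {suc s} (small (suc s) (s≤s (m≤m+n K r))))) ⟩
    -- The coefficient 3 comes from the geometric tail: the sum of `(3/4)^j` over `j > s` is
    -- `3 (3/4)^s`, so the reserve pays for the new term exactly.
    4 * (2 ^ s * u) + (3 ^ suc s + 3 * 3 ^ suc s)      R.≡⟨ lemma″ (2 ^ s * u) (3 ^ s) ⟩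
    4 * (2 ^ s * u + 3 * 3 ^ s)                        R.≤⟨ *-monoʳ-≤ 4 inv ⟩
    4 ^ suc s                                          R.∎)
  where
  open ≡-Reasoning
  module R = ≤-Reasoning
  s = K + r
  c = d (P + suc s)
  lemma : ∀ a x u c → 2 * (a * x + u) + c ≡ a * (2 * x) + (2 * u + c)
  lemma = solve-∀
  lemma′ : ∀ x u c y → 2 * x * (2 * u + c) + 3 * y ≡ 4 * (x * u) + (2 * x * c + 3 * y)
  lemma′ = solve-∀
  lemma″ : ∀ x y → 4 * x + (3 * y + 3 * (3 * y)) ≡ 4 * (x + 3 * y)
  lemma″ = solve-∀

floor-partial : ∀ P K a → 4 ≤ K → A (P + K) ≡ a * 2 ^ K → (∀ i → K < i → d (P + i) * d (P + i) ≤ 2 ^ i) →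
                ∀ N → P + K ≤ N → floorScaledPartial P N ≡ a
floor-partial P K a 4≤K eq small N P+K≤N with m≤n⇒∃[o]m+o≡n P+K≤N
... | r , refl with A-tail P K a 4≤K eq small r
...   | u , eq′ , inv = /-unique {q = a} {r = u * 2 ^ P} {{m^n≢0 2 (P + K + r)}} (begin-equality
    A (P + K + r) * 2 ^ P                      ≡⟨ cong (λ j → A j * 2 ^ P) (+-assoc P K r) ⟩
    A (P + s) * 2 ^ P                          ≡⟨ cong (_* 2 ^ P) eq′ ⟩
    (a * 2 ^ s + u) * 2 ^ P                    ≡⟨ lemma a (2 ^ s) u (2 ^ P) ⟩
    a * (2 ^ P * 2 ^ s) + u * 2 ^ P            ≡⟨ cong (λ j → a * j + u * 2 ^ P) pow ⟨
    a * 2 ^ (P + K + r) + u * 2 ^ P            ∎)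
  (begin-strict
    u * 2 ^ P          <⟨ *-monoˡ-< (2 ^ P) {{m^n≢0 2 P}} u<2^s ⟩
    2 ^ s * 2 ^ P      ≡⟨ trans (*-comm (2 ^ s) (2 ^ P)) (sym pow) ⟩
    2 ^ (P + K + r)    ∎)
  where
  open ≤-Reasoning
  s = K + r
  lemma : ∀ a x u y → (a * x + u) * y ≡ a * (y * x) + u * y
  lemma = solve-∀
  pow : 2 ^ (P + K + r) ≡ 2 ^ P * 2 ^ s
  pow = trans (cong (2 ^_) (+-assoc P K r)) (^-distribˡ-+-* 2 P s)
  u<2^s : u < 2 ^ s
  u<2^s = *-cancelˡ-< (2 ^ s) u (2 ^ s) (begin-strict
    -- The reserve `3 * 3 ^ s` is positive, so the tail is strictly below one unit and causes no
    -- carry.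
    2 ^ s * u                  <⟨ m<m+n (2 ^ s * u) (*-mono-< {0} {3} {0} (s≤s z≤n) (m^n>0 3 s)) ⟩
    2 ^ s * u + 3 * 3 ^ s      ≤⟨ inv ⟩
    4 ^ s                      ≡⟨ ^-distribʳ-* s 2 2 ⟩
    2 ^ s * 2 ^ s              ∎)

floor-half : ∀ n N → floorScaledPartial n N ≡ floorScaledPartial (suc n) N / 2
floor-half n N = begin
  A N * 2 ^ n / 2 ^ N                     ≡⟨ m*n/o*n≡m/o (A N * 2 ^ n) 2 (2 ^ N) ⟨
  A N * 2 ^ n * 2 / (2 ^ N * 2)           ≡⟨ m/n/o≡m/[n*o] (A N * 2 ^ n * 2) (2 ^ N) 2 ⟨
  A N * 2 ^ n * 2 / 2 ^ N / 2             ≡⟨ cong (λ j → j / 2 ^ N / 2) (lemma (A N) (2 ^ n)) ⟩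
  A N * (2 * 2 ^ n) / 2 ^ N / 2           ∎
  where
  open ≡-Reasoning
  instance
    _ = m^n≢0 2 N
    _ = m*n≢0 (2 ^ N) 2
  lemma : ∀ a x → a * x * 2 ≡ a * (2 * x)
  lemma = solve-∀

digits-11 : ∀ n K a → 4 ≤ K → A (suc n + K) ≡ (3 + a * 4) * 2 ^ K → (∀ i → K < i → d (suc n + i) * d (suc n + i) ≤ 2 ^ i) →
            EBinaryDigit≡ n 1 × EBinaryDigit≡ (suc n) 1
digits-11 n K a 4≤K eq small = (suc n + K , upper) , (suc n + K , lower)
  where
  floor : ∀ N → suc n + K ≤ N → floorScaledPartial (suc n) N ≡ 3 + a * 4
  floor = floor-partial (suc n) K (3 + a * 4) 4≤K eq small
  lower : ∀ N → suc n + K ≤ N → floorScaledPartial (suc n) N % 2 ≡ 1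
  lower N le = trans (cong (_% 2) (trans (floor N le) (lemma a))) ([m+kn]%n≡m%n 1 (suc (2 * a)) 2)
    where lemma : ∀ a → 3 + a * 4 ≡ 1 + (1 + 2 * a) * 2
          lemma = solve-∀
  upper : ∀ N → suc n + K ≤ N → floorScaledPartial n N % 2 ≡ 1
  upper N le = trans (cong (_% 2) (trans (floor-half n N) (/-unique {q = 1 + a * 2} (trans (floor N le) (lemma a)) (s≤s (s≤s z≤n))))) ([m+kn]%n≡m%n 1 a 2)
    where lemma : ∀ a → 3 + a * 4 ≡ (1 + a * 2) * 2 + 1
          lemma = solve-∀

square-digits : ∀ s K → let S = 2 + s in 4 ≤ K → d (S * S) % 4 ≡ 3 → (∀ i → 1 ≤ i → i ≤ K → 2 ^ (2 + i) ∣ d (S * S + i)) →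
                (∀ i → K < i → d (S * S + i) * d (S * S + i) ≤ 2 ^ i) →
                EBinaryDigit≡ (pred (S * S)) 1 × EBinaryDigit≡ (S * S) 1
square-digits s K 4≤K dS²≡3 div small with A-block (S * S) K div K ≤-refl | d-even (pred (S * S)) (between-squares {z = suc s} lo hi)
  where
  S = 2 + s
  -- This is where `S ≥ 2` matters: for `S = 1` the predecessor would be the square 0.
  lo : suc s * suc s < pred (S * S)
  lo = ≤-trans (m≤m+n _ (suc (2 * s))) (≤-reflexive (lemma s))
    where lemma : ∀ s → suc (suc s * suc s) + suc (2 * s) ≡ suc s + suc s * (2 + s)
          lemma = solve-∀
  hi : pred (S * S) < S * S
  hi = ≤-refl
... | q , eq | divides w eq′ = digits-11 (pred (S * S)) K (A n + w + dS² / 4 + q) 4≤K (trans eq (cong (_* 2 ^ K) mod4)) small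
  where
  S = 2 + s
  n = pred (pred (S * S))
  dS² = d (S * S)
  open ≡-Reasoning
  lemma : ∀ a w r q → 2 * (2 * a + w * 2) + (3 + r * 4) + 4 * q ≡ 3 + (a + w + r + q) * 4
  lemma = solve-∀
  mod4 : A (S * S) + 4 * q ≡ 3 + (A n + w + dS² / 4 + q) * 4
  mod4 = begin
    2 * (2 * A n + d (suc n)) + dS² + 4 * q               ≡⟨ cong₂ (λ x y → 2 * (2 * A n + x) + y + 4 * q) eq′ (trans (m≡m%n+[m/n]*n dS² 4) (cong (_+ dS² / 4 * 4) dS²≡3)) ⟩
    2 * (2 * A n + w * 2) + (3 + dS² / 4 * 4) + 4 * q     ≡⟨ lemma (A n) w (dS² / 4) q ⟩
    3 + (A n + w + dS² / 4 + q) * 4                       ∎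

-- Unitary divisors and congruences

coprime-* : ∀ {a b n} → Coprime a n → Coprime b n → Coprime (a * b) n
coprime-* {a} a⊥n b⊥n (k∣ab , k∣n) =
  b⊥n (coprime-divisor {n = a} (λ (l∣k , l∣a) → a⊥n (l∣a , ∣-trans l∣k k∣n)) k∣ab , k∣n)

-- Unitary divisibility: coprimality with the cofactor is what lets `d-coprime` split off `d c`.
_∥_ : ℕ → ℕ → Set
c ∥ n = ∃[ g ] (n ≡ c * g × Coprime c g)

∥-cancelˡ : ∀ {c} a {n} .{{_ : NonZero c}} → Coprime c a → c ∥ (a * n) → c ∥ n
∥-cancelˡ {c} a {n} c⊥a (g , an≡cg , c⊥g) with coprime-divisor {c} {a} {n} c⊥a (divides g (trans an≡cg (*-comm c g)))
... | divides g′ n≡g′c = g′ , trans n≡g′c (*-comm g′ c) , λ (k∣c , k∣g′) → c⊥g (k∣c , subst (_ ∣_) (sym g≡ag′) (∣n⇒∣m*n a k∣g′))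
  where
  lemma : ∀ a g c → a * (g * c) ≡ c * (a * g)
  lemma = solve-∀
  g≡ag′ : g ≡ a * g′
  g≡ag′ = *-cancelˡ-≡ g (a * g′) c (trans (sym an≡cg) (trans (cong (a *_) n≡g′c) (lemma a g′ c)))

-- The divisors are split off two at a time: a single `c r` might be a square with `d (c r)` odd,
-- but the product of two neighbours has an even number of divisors. Pairwise coprimality keeps the
-- remaining `c r` unitary in the cofactor.
2^∣d : ∀ m (c : ℕ → ℕ) → (∀ r → NonZero (c r)) → (∀ {r s} → r < s → s < 2 * m → Coprime (c r) (c s)) →
       (∀ r → suc r < 2 * m → 2 ∣ d (c r * c (suc r))) →
       ∀ n .{{_ : NonZero n}} → (∀ r → r < 2 * m → c r ∥ n) → 2 ^ m ∣ d n
2^∣d zero    c c≢0 coprime even n unitary = 1∣ d n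
2^∣d (suc m) c c≢0 coprime even n unitary = strip (unitary 0 0<)
  where
  shift : ∀ {r} → r < 2 * m → 2 + r < 2 * suc m
  shift r< = ≤-trans (s≤s (s≤s r<)) (≤-reflexive (sym (*-suc 2 m)))
  0< : 0 < 2 * suc m
  0< = s≤s z≤n
  1< : 1 < 2 * suc m
  1< = ≤-trans (s≤s (s≤s z≤n)) (≤-reflexive (sym (*-suc 2 m)))
  open ≡-Reasoning
  strip₂ : ∀ {g} → n ≡ c 0 * g → Coprime (c 0) g → c 1 ∥ g → 2 ^ suc m ∣ d n
  strip₂ {g} n≡cg c₀⊥g (g′ , g≡cg′ , c₁⊥g′) = subst (2 ^ suc m ∣_) (sym dn) (*-pres-∣ (even 0 1<) rest)
    where
    instance
      c₀≢0 = c≢0 0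
      c₁≢0 = c≢0 1
      g≢0 : NonZero g
      g≢0 = m*n≢0⇒n≢0 (c 0) {g} {{subst NonZero n≡cg (≢-nonZero (≢-nonZero⁻¹ n))}}
    instance
      g′≢0 : NonZero g′
      g′≢0 = m*n≢0⇒n≢0 (c 1) {g′} {{subst NonZero g≡cg′ g≢0}}
    dn : d n ≡ d (c 0 * c 1) * d g′
    dn = begin
      d n                        ≡⟨ cong d n≡cg ⟩
      d (c 0 * g)                ≡⟨ d-coprime (c 0) g c₀⊥g ⟩
      d (c 0) * d g              ≡⟨ cong (λ k → d (c 0) * d k) g≡cg′ ⟩
      d (c 0) * d (c 1 * g′)     ≡⟨ cong (d (c 0) *_) (d-coprime (c 1) g′ c₁⊥g′) ⟩
      d (c 0) * (d (c 1) * d g′) ≡⟨ *-assoc (d (c 0)) _ _ ⟨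
      d (c 0) * d (c 1) * d g′   ≡⟨ cong (_* d g′) (d-coprime (c 0) (c 1) (coprime ≤-refl 1<)) ⟨
      d (c 0 * c 1) * d g′       ∎
    rest : 2 ^ m ∣ d g′
    rest = 2^∣d m (λ r → c (2 + r)) (λ r → c≢0 (2 + r))
      (λ r<s s< → coprime (s≤s (s≤s r<s)) (shift s<)) (λ r r< → even (2 + r) (shift r<)) g′
      λ r r< → ∥-cancelˡ (c 1) {{c≢0 (2 + r)}} (coprime-sym (coprime (s≤s (s≤s z≤n)) (shift r<)))
        (subst (c (2 + r) ∥_) g≡cg′ (∥-cancelˡ (c 0) {{c≢0 (2 + r)}} (coprime-sym (coprime (s≤s z≤n) (shift r<)))
          (subst (c (2 + r) ∥_) n≡cg (unitary (2 + r) (shift r<)))))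
  strip : c 0 ∥ n → 2 ^ suc m ∣ d n
  strip (g , n≡cg , c₀⊥g) = strip₂ n≡cg c₀⊥g
    (∥-cancelˡ (c 0) {g} {{c≢0 1}} (coprime-sym (coprime ≤-refl 1<)) (subst (c 1 ∥_) n≡cg (unitary 1 1<)))

-- A multiple of `m` is added on each side, so that no subtraction of naturals is needed.
record _≡_[mod_] (x r m : ℕ) : Set where
  constructor modular
  field
    k l : ℕ
    equation : x + k * m ≡ r + l * m

≡-mod-*ˡ : ∀ {x y} p q → x ≡ y [mod p * q ] → x ≡ y [mod q ]
≡-mod-*ˡ {x} {y} p q (modular k l eq) = modular (k * p) (l * p)
  (trans (cong (x +_) (*-assoc k p q)) (trans eq (cong (y +_) (sym (*-assoc l p q)))))

≡-mod-trans : ∀ {x y z m} → x ≡ y [mod m ] → y ≡ z [mod m ] → x ≡ z [mod m ]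
≡-mod-trans {x} {y} {z} {m} (modular k l eq) (modular k′ l′ eq′) = modular (k + k′) (l′ + l) (begin
  x + (k + k′) * m          ≡⟨ lemma x k k′ m ⟩
  x + k * m + k′ * m        ≡⟨ cong (_+ k′ * m) eq ⟩
  y + l * m + k′ * m        ≡⟨ lemma′ y l k′ m ⟩
  y + k′ * m + l * m        ≡⟨ cong (_+ l * m) eq′ ⟩
  z + l′ * m + l * m        ≡⟨ lemma z l′ l m ⟨
  z + (l′ + l) * m          ∎)
  where
  open ≡-Reasoning
  lemma : ∀ x k k′ m → x + (k + k′) * m ≡ x + k * m + k′ * m
  lemma = solve-∀
  lemma′ : ∀ x k k′ m → x + k * m + k′ * m ≡ x + k′ * m + k * m
  lemma′ = solve-∀

mod-inverse : ∀ {P m} .{{_ : NonZero m}} → Coprime P m → ∃[ u ] (u * P) ≡ 1 [mod m ]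
mod-inverse {P} {m@(suc m-1)} P⊥m with coprime-Bézout P⊥m
... | Bézout.+- x y eq = x , modular 0 y (trans (+-identityʳ _) (sym eq))
-- Here `1 + x * P = y * m`, so the inverse is `-x`, represented by `m-1 * x`.
... | Bézout.-+ x y eq = m-1 * x , modular 1 (m-1 * y) (begin
  m-1 * x * P + 1 * m       ≡⟨ lemma m-1 x P ⟩
  1 + m-1 * (1 + x * P)     ≡⟨ cong (λ k → 1 + m-1 * k) eq ⟩
  1 + m-1 * (y * m)         ≡⟨ cong suc (*-assoc m-1 y m) ⟨
  1 + m-1 * y * m           ∎)
  where
  open ≡-Reasoning
  lemma : ∀ m x P → m * x * P + 1 * suc m ≡ 1 + m * (1 + x * P)
  lemma = solve-∀

crt₂ : ∀ {P m} .{{_ : NonZero m}} → Coprime P m → ∀ a r → ∃[ x ] (x ≡ a [mod P ] × x ≡ r [mod m ])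
crt₂ {P} {m@(suc m-1)} P⊥m a r with mod-inverse P⊥m
... | u , modular k l eq = a + w * u * P , modular 0 (w * u) (+-identityʳ _) , modular (w * k) (a + w * l) (begin
  a + w * u * P + w * k * m      ≡⟨ lemma a w u P k m ⟩
  a + w * (u * P + k * m)        ≡⟨ cong (λ j → a + w * j) eq ⟩
  a + w * (1 + l * m)            ≡⟨ lemma′ a r m-1 l ⟩
  r + (a + w * l) * m            ∎)
  where
  open ≡-Reasoning
  -- `m-1 * a` represents `-a`, so `w` is `r - a` modulo `m` and `a + w * u * P` moves `a` to `r`.
  w = r + m-1 * a
  lemma : ∀ a w u P k m → a + w * u * P + w * k * m ≡ a + w * (u * P + k * m)
  lemma = solve-∀
  lemma′ : ∀ a r m l → a + (r + m * a) * (1 + l * suc m) ≡ r + (a + (r + m * a) * l) * suc m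
  lemma′ = solve-∀

∏ : ℕ → (ℕ → ℕ) → ℕ
∏ zero    f = 1
∏ (suc n) f = f n * ∏ n f

∏≢0 : ∀ n {f} → (∀ e → NonZero (f e)) → NonZero (∏ n f)
∏≢0 zero    f≢0 = _
∏≢0 (suc n) {f} f≢0 = m*n≢0 (f n) (∏ n f) {{f≢0 n}} {{∏≢0 n f≢0}}

∏≤^ : ∀ n {f b} → (∀ e → e < n → f e ≤ b) → ∏ n f ≤ b ^ n
∏≤^ zero    h = ≤-refl
∏≤^ (suc n) h = *-mono-≤ (h n ≤-refl) (∏≤^ n (λ e e<n → h e (m<n⇒m<1+n e<n)))

coprime-∏ : ∀ n {f m} → (∀ e → e < n → Coprime (f e) m) → Coprime (∏ n f) m
coprime-∏ zero    h (k∣1 , _) = ∣1⇒≡1 k∣1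
coprime-∏ (suc n) h = coprime-* (h n ≤-refl) (coprime-∏ n (λ e e<n → h e (m<n⇒m<1+n e<n)))

∏-factor : ∀ n {f} {e} → e < n → ∃[ p ] ∏ n f ≡ p * f e
∏-factor (suc k) {f} {e} e<1+k with e ≟ k
... | yes refl = ∏ k f , *-comm (f k) _
... | no e≢k with ∏-factor k {f} (≤∧≢⇒< (≤-pred e<1+k) e≢k)
...   | p , eq = f k * p , trans (cong (f k *_) eq) (sym (*-assoc (f k) p (f e)))

crt : ∀ n (m r : ℕ → ℕ) → (∀ e → NonZero (m e)) → (∀ {e f} → e < f → f < n → Coprime (m e) (m f)) →
      ∃[ x ] (∀ e → e < n → x ≡ r e [mod m e ])
crt zero    m r m≢0 coprime = 0 , λ _ ()
crt (suc n) m r m≢0 coprime with crt n m r m≢0 (λ e<f f<n → coprime e<f (m<n⇒m<1+n f<n))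
... | a , ha with crt₂ {∏ n m} {m n} {{m≢0 n}} (coprime-∏ n (λ e e<n → coprime e<n ≤-refl)) a (r n)
...   | x , x≡a , x≡r = x , solves
  where
  solves : ∀ e → e < suc n → x ≡ r e [mod m e ]
  solves e e<1+n with e ≟ n
  ... | yes refl = x≡r
  ... | no e≢n with ∏-factor n {m} (≤∧≢⇒< (≤-pred e<1+n) e≢n)
  ...   | p , eq = ≡-mod-trans (≡-mod-*ˡ p (m e) (subst (x ≡ a [mod_]) eq x≡a)) (ha e (≤∧≢⇒< (≤-pred e<1+n) e≢n))

gcd-*≤ : ∀ a b n .{{_ : NonZero n}} → gcd (a * b) n ≤ gcd a n * gcd b n
gcd-*≤ a b n = ∣⇒≤ {{m*n≢0 (gcd a n) (gcd b n) {{gcd≢0 a}} {{gcd≢0 b}}}}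
  (subst (gcd (a * b) n ∣_) (*-comm (gcd b n) (gcd a n)) (∣gcd* b n (gcd a n)
    (subst (gcd (a * b) n ∣_) (*-comm (gcd a n) b) (∣gcd* a n b (gcd[m,n]∣m (a * b) n) (∣m⇒∣m*n b (gcd[m,n]∣n (a * b) n))))
    (∣m⇒∣m*n (gcd a n) (gcd[m,n]∣n (a * b) n))))
  where
  gcd≢0 : ∀ a → NonZero (gcd a n)
  gcd≢0 a = ≢-nonZero (gcd[m,n]≢0 a n (inj₂ (≢-nonZero⁻¹ n)))

gcd-∏≤ : ∀ k f n .{{_ : NonZero n}} → gcd (∏ k f) n ≤ ∏ k (λ e → gcd (f e) n)
gcd-∏≤ zero    f n = ≤-reflexive (gcd-zeroˡ n)
gcd-∏≤ (suc k) f n = ≤-trans (gcd-*≤ (f k) (∏ k f) n) (*-monoʳ-≤ (gcd (f k) n) (gcd-∏≤ k f n))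

-- The moduli

-- c(b) c(b+1) = (A b (b+1) + 1)² + A for c(b) = A b² + 1, which lies strictly between two squares.
consecutive-nonsquare : ∀ A b .{{_ : NonZero A}} .{{_ : NonZero b}} →
                        ∀ a → a * a ≢ suc (A * (b * b)) * suc (A * (suc b * suc b))
consecutive-nonsquare A b = between-squares {z = Z}
  (≤-trans (≤-trans (≤-reflexive (+-comm 1 (Z * Z))) (+-monoʳ-≤ (Z * Z) (n≢0⇒n>0 (≢-nonZero⁻¹ A)))) (≤-reflexive (sym (identity A b))))
  (begin-strict
    suc (A * (b * b)) * suc (A * (suc b * suc b))   ≡⟨ identity A b ⟩
    Z * Z + A                                       <⟨ +-monoʳ-< (Z * Z) A<1+2Z ⟩
    Z * Z + suc (2 * Z)                             ≡⟨ expand Z ⟩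
    suc Z * suc Z                                   ∎)
  where
  open ≤-Reasoning
  Z = suc (A * (b * suc b))
  identity : ∀ A b → suc (A * (b * b)) * suc (A * (suc b * suc b)) ≡ suc (A * (b * suc b)) * suc (A * (b * suc b)) + A
  identity = solve-∀
  expand : ∀ Z → Z * Z + suc (2 * Z) ≡ suc Z * suc Z
  expand = solve-∀
  A<1+2Z : A < suc (2 * Z)
  A<1+2Z = s≤s (≤-trans (m≤m*n A (b * suc b) {{m*n≢0 b (suc b)}}) (≤-trans (n≤1+n _) (m≤n*m Z 2)))

-- Modulo `C * C` the number `x * x + j` is `j * C`, so its cofactor is `j` modulo `C`; and
-- `C = 1 + j q` is coprime to `j`. The congruence is taken modulo the square in order to see the
-- cofactor.
exact-divisor : ∀ {x r j C q} .{{_ : NonZero C}} → r * r + j ≡ j * C → C ≡ suc (j * q) → x ≡ r [mod C * C ] → C ∥ (x * x + j)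
exact-divisor {x} {r} {j} {C} {q} root C≡ (modular k l eq) = strip C∣
  where
  α β : ℕ
  α = k * (2 * x + k * (C * C))
  β = l * (2 * r + l * (C * C))
  lemma : ∀ x k C j → x * x + j + C * (C * (k * (2 * x + k * (C * C)))) ≡ (x + k * (C * C)) * (x + k * (C * C)) + j
  lemma = solve-∀
  open ≡-Reasoning
  key : x * x + j + C * (C * α) ≡ j * C + C * (C * β)
  key = begin
    x * x + j + C * (C * α)                       ≡⟨ lemma x k C j ⟩
    (x + k * (C * C)) * (x + k * (C * C)) + j     ≡⟨ cong (λ y → y * y + j) eq ⟩
    (r + l * (C * C)) * (r + l * (C * C)) + j     ≡⟨ lemma r l C j ⟨
    r * r + j + C * (C * β)                       ≡⟨ cong (_+ C * (C * β)) root ⟩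
    j * C + C * (C * β)                           ∎
  C∣ : C ∣ x * x + j
  C∣ = ∣m+n∣m⇒∣n (subst (C ∣_) (trans (sym key) (+-comm _ (C * (C * α)))) (∣m∣n⇒∣m+n (n∣m*n j) (m∣m*n (C * β)))) (m∣m*n (C * α))
  strip : C ∣ x * x + j → C ∥ (x * x + j)
  strip (divides g n≡gC) = g , trans n≡gC (*-comm g C) , coprime
    where
    cofactor : g + C * α ≡ j + C * β
    cofactor = *-cancelˡ-≡ (g + C * α) (j + C * β) C (begin
      C * (g + C * α)              ≡⟨ *-distribˡ-+ C g (C * α) ⟩
      C * g + C * (C * α)          ≡⟨ cong (_+ C * (C * α)) (trans n≡gC (*-comm g C)) ⟨
      x * x + j + C * (C * α)      ≡⟨ key ⟩
      j * C + C * (C * β)          ≡⟨ cong (_+ C * (C * β)) (*-comm j C) ⟩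
      C * j + C * (C * β)          ≡⟨ *-distribˡ-+ C j (C * β) ⟨
      C * (j + C * β)              ∎)
    coprime : Coprime C g
    coprime {h} (h∣C , h∣g) = ∣1⇒≡1 (∣m+n∣m⇒∣n (subst (h ∣_) (trans C≡ (+-comm 1 (j * q))) h∣C) (∣m⇒∣m*n q h∣j))
      where
      h∣j : h ∣ j
      h∣j = ∣m+n∣m⇒∣n (subst (h ∣_) (trans cofactor (+-comm j (C * β))) (∣m∣n⇒∣m+n h∣g (∣m⇒∣m*n α h∣C))) (∣m⇒∣m*n β h∣C)

≤⇒∣! : ∀ {k n} .{{_ : NonZero k}} → k ≤ n → k ∣ n !
≤⇒∣! {suc k} k<n = ∣-trans (m∣m*n (k !)) (m≤n⇒m!∣n! k<n)

%-≡-mod : ∀ x m .{{_ : NonZero m}} → (x % m) ≡ x [mod m ]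
%-≡-mod x m = modular (x / m) 0 (trans (sym (m≡m%n+[m/n]*n x m)) (sym (+-identityʳ x)))

module Congruences (n : ℕ) (m r : ℕ → ℕ) (m≢0 : ∀ e → NonZero (m e))
                   (coprime : ∀ {e f} → e < f → f < n → Coprime (m e) (m f)) (m⊥4 : ∀ e → Coprime (m e) 4) where

  modulus : ℕ
  modulus = ∏ n m * 4

  instance
    modulus≢0 : NonZero modulus
    modulus≢0 = m*n≢0 (∏ n m) 4 {{∏≢0 n m≢0}}

  -- The class 2 modulo 4 makes `x` twice an odd number, as the choice between `x` and `x/2`
  -- requires.
  Admissible : ℕ → Set
  Admissible x = x ≡ 2 [mod 4 ] × (∀ e → e < n → x ≡ r e [mod m e ])

  mod-∏ : ∀ {x y} → y ≡ x [mod ∏ n m ] → ∀ e → e < n → y ≡ x [mod m e ]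
  mod-∏ {x} {y} y≡x e e<n with ∏-factor n {m} e<n
  ... | p , eq = ≡-mod-*ˡ p (m e) (subst (y ≡ x [mod_]) eq y≡x)

  admissible-mod : ∀ {x y} → y ≡ x [mod modulus ] → Admissible x → Admissible y
  admissible-mod {x} {y} y≡x (x≡2 , x≡r) = ≡-mod-trans (≡-mod-*ˡ (∏ n m) 4 y≡x) x≡2 ,
    λ e e<n → ≡-mod-trans (mod-∏ (≡-mod-*ˡ 4 (∏ n m) (subst (y ≡ x [mod_]) (*-comm (∏ n m) 4) y≡x)) e e<n) (x≡r e e<n)

  exists-admissible : ∃[ x ] (x < modulus × Admissible x)
  exists-admissible = x % modulus , m%n<n x modulus ,
    admissible-mod (%-≡-mod x modulus) (proj₂ (proj₂ solution) , λ e e<n → ≡-mod-trans (mod-∏ (proj₁ (proj₂ solution)) e e<n) (proj₂ partial e e<n))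
    where
    partial : ∃[ a ] (∀ e → e < n → a ≡ r e [mod m e ])
    partial = crt n m r m≢0 coprime
    solution : ∃[ x ] (x ≡ proj₁ partial [mod ∏ n m ] × x ≡ 2 [mod 4 ])
    solution = crt₂ (coprime-∏ n (λ e _ → m⊥4 e)) (proj₁ partial) 2
    x = proj₁ solution

  gcd-modulus≤ : ∀ N .{{_ : NonZero N}} {b} → (∀ e → e < n → gcd (m e) N ≤ b) → gcd modulus N ≤ b ^ n * 4
  gcd-modulus≤ N {b} small = begin
    gcd (∏ n m * 4) N                    ≤⟨ gcd-*≤ (∏ n m) 4 N ⟩
    gcd (∏ n m) N * gcd 4 N              ≤⟨ *-mono-≤ (gcd-∏≤ n m N) (∣⇒≤ (gcd[m,n]∣m 4 N)) ⟩
    ∏ n (λ e → gcd (m e) N) * 4          ≤⟨ *-monoˡ-≤ 4 (∏≤^ n small) ⟩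
    b ^ n * 4                            ∎
    where open ≤-Reasoning

-- Limits how far a modulus built for the shift `j` interferes with a later shift `i`: a common
-- divisor divides the difference of `y + i` and `y + j`.
gcd∣gap : ∀ {c i} y j w → c ∣ y + j → j + w ≡ i → gcd c (y + i) ∣ w
gcd∣gap {c} y j w c∣y+j refl = ∣m+n∣m⇒∣n
  (subst (gcd c (y + (j + w)) ∣_) (sym (+-assoc y j w)) (gcd[m,n]∣n c (y + (j + w))))
  (∣-trans (gcd[m,n]∣m c (y + (j + w))) c∣y+j)

module Moduli (K L B : ℕ) .{{_ : NonZero L}} (B-large : K * (K * L * (K * L)) ≤ B) (4≤B : 4 ≤ B) where

  -- `F` makes each `c e` congruent to 1 modulo every number from 1 to `B`, hence coprime to 4, to
  -- the differences of the `v e`, and to `i - shift e` for `K < i ≤ B`.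
  E F : ℕ
  E = K * L
  F = B !

  -- The indices e with shift e = i form the block of L moduli that act on x² + i.
  shift v c r : ℕ → ℕ
  shift e = suc (e / L)
  v e = shift e * (suc e * suc e)
  c e = suc (v e * (F * F))
  r e = shift e * (F * suc e)

  shift≤K : ∀ {e} → e < E → shift e ≤ K
  shift≤K e<E = m<n*o⇒m/o<n e<E

  v≤B : ∀ {e} → e < E → v e ≤ B
  v≤B e<E = ≤-trans (*-mono-≤ (shift≤K e<E) (*-mono-≤ e<E e<E)) B-large

  -- The index `suc e` does not restart with each block, so the `v e` differ across shifts as well
  -- as within one.
  v-mono : ∀ {e f} → e < f → v e < v f
  v-mono {e} {f} e<f = ≤-trans (*-monoʳ-< (shift e) (*-mono-< (s≤s e<f) (s≤s e<f)))
                               (*-monoˡ-≤ (suc f * suc f) (s≤s (/-monoˡ-≤ L (<⇒≤ e<f))))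

  c⊥∣F : ∀ e {k} → k ∣ F → Coprime (c e) k
  c⊥∣F e k∣F {l} (l∣c , l∣k) = ∣1⇒≡1 (∣m+n∣m⇒∣n {m = v e * (F * F)} (subst (l ∣_) (+-comm 1 (v e * (F * F))) l∣c) (∣n⇒∣m*n (v e) (∣m⇒∣m*n F (∣-trans l∣k k∣F))))

  -- A common divisor divides `(v f - v e) * F²` and is coprime to `F`, so it divides `v f - v e`.
  -- That difference is at most `B`, hence divides `F`.
  c-coprime : ∀ {e f} → e < f → f < E → Coprime (c e) (c f)
  c-coprime {e} {f} e<f f<E {k} (k∣ce , k∣cf) with m≤n⇒∃[o]m+o≡n (v-mono e<f)
  ... | w , eq = c⊥∣F e (≤⇒∣! (≤-trans (≤-trans (m≤n+m (suc w) (v e)) (≤-reflexive (trans (+-suc (v e) w) eq))) (v≤B f<E))) (k∣ce , k∣w)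
    where
    k⊥F : Coprime k F
    k⊥F (l∣k , l∣F) = c⊥∣F e ∣-refl (∣-trans l∣k k∣ce , l∣F)
    lemma : ∀ v w F → suc ((suc v + w) * (F * F)) ≡ suc (v * (F * F)) + F * (F * suc w)
    lemma = solve-∀
    k∣w : k ∣ suc w
    k∣w = coprime-divisor k⊥F (coprime-divisor k⊥F (∣m+n∣m⇒∣n (subst (k ∣_) (trans (cong (λ a → suc (a * (F * F))) (sym eq)) (lemma (v e) w F)) k∣cf) k∣ce))

  c⊥4 : ∀ e → Coprime (c e) 4
  c⊥4 e = c⊥∣F e (≤⇒∣! 4≤B)

  c²⊥c² : ∀ {e f} → e < f → f < E → Coprime (c e * c e) (c f * c f)
  c²⊥c² {e} {f} e<f f<E = coprime-* c⊥c² c⊥c²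
    where
    c⊥c² : Coprime (c e) (c f * c f)
    c⊥c² = coprime-sym (coprime-* (coprime-sym (c-coprime e<f f<E)) (coprime-sym (c-coprime e<f f<E)))

  open Congruences E (λ e → c e * c e) r (λ e → m*n≢0 (c e) (c e)) c²⊥c² (λ e → coprime-* (c⊥4 e) (c⊥4 e)) public

  -- `r e` is an explicit root: with `j = shift e` and `b = suc e`,
  -- `(j F b)² + j = j (j b² F² + 1) = j * c e`.
  c∥ : ∀ {x} → Admissible x → ∀ e → e < E → c e ∥ (x * x + shift e)
  c∥ (_ , x≡r) e e<E = exact-divisor (lemma (shift e) F (suc e)) (cong suc (*-assoc (shift e) (suc e * suc e) (F * F))) (x≡r e e<E)
    where lemma : ∀ j F b → j * (F * b) * (j * (F * b)) + j ≡ j * suc (j * (b * b) * (F * F))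
          lemma = solve-∀

  block-even : ∀ e → shift (suc e) ≡ shift e → 2 ∣ d (c e * c (suc e))
  block-even e same = d-even (c e * c (suc e)) λ a eq → consecutive-nonsquare (j * (F * F)) (suc e) {{m*n≢0 j (F * F) {{_}} {{m*n≢0 F F {{B !≢0}} {{B !≢0}}}}}} a
    (trans eq (cong₂ (λ x y → suc x * suc y) (lemma j (suc e) F) (trans (cong (λ i → i * (suc (suc e) * suc (suc e)) * (F * F)) same) (lemma j (suc (suc e)) F))))
    where
    j = shift e
    lemma : ∀ j b F → j * (b * b) * (F * F) ≡ j * (F * F) * (b * b)
    lemma = solve-∀

  -- The factor `a` is 1 when `n` belongs to `x` and 4 when `n` belongs to `x/2`; being coprime to
  -- `a`, the moduli pass from `a * n` to `n`. The index `i` counts blocks from 0, whereas shifts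
  -- start at 1.
  2^∣d-admissible : ∀ {x} → Admissible x → ∀ m → 2 * m ≤ L → ∀ i → i < K → ∀ a n .{{_ : NonZero n}} → (∀ e → Coprime (c e) a) →
                    a * n ≡ x * x + suc i → 2 ^ m ∣ d n
  2^∣d-admissible {x} adm m 2m≤L i i<K a n c⊥a an≡ = 2^∣d m (λ ρ → c (u + ρ)) (λ _ → _)
    (λ ρ<σ σ< → c-coprime (+-monoʳ-< u ρ<σ) (in-range σ<))
    (λ ρ 1+ρ< → subst (λ f → 2 ∣ d (c (u + ρ) * c f)) (sym (+-suc u ρ)) (block-even (u + ρ)
      (trans (cong shift (sym (+-suc u ρ))) (trans (shift-block 1+ρ<) (sym (shift-block (<⇒≤ 1+ρ<)))))))
    n
    (λ ρ ρ< → ∥-cancelˡ a (c⊥a (u + ρ)) (subst (c (u + ρ) ∥_) (trans (cong (x * x +_) (shift-block ρ<)) (sym an≡)) (c∥ adm (u + ρ) (in-range ρ<))))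
    where
    u = i * L
    in-range : ∀ {ρ} → ρ < 2 * m → u + ρ < E
    in-range ρ< = ≤-trans (+-monoʳ-< u (≤-trans ρ< 2m≤L)) (≤-trans (≤-reflexive (+-comm u L)) (*-monoˡ-≤ L i<K))
    shift-block : ∀ {ρ} → ρ < 2 * m → shift (u + ρ) ≡ suc i
    shift-block ρ< = cong suc (/-unique {q = i} refl (≤-trans ρ< 2m≤L))

  rootGcd≤ : ∀ {x g} i .{{_ : NonZero i}} → (∀ e → e < E → gcd (c e) (x * x + i) ≤ g) →
             rootGcd x modulus i ≤ (g * g) ^ E * 4
  rootGcd≤ {x} {g} i small = gcd-modulus≤ N λ e e<E → ≤-trans (gcd-*≤ (c e) (c e) N) (*-mono-≤ (small e e<E) (small e e<E))
    where
    N = x * x + i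
    instance _ = ≢-nonZero {N} λ eq → ≢-nonZero⁻¹ i (m+n≡0⇒n≡0 (x * x) eq)

  module _ {x} (adm : Admissible x) {i} (K<i : K < i) {e} (e<E : e < E) where

    c∣ : c e ∣ x * x + shift e
    c∣ = divides (proj₁ (c∥ adm e e<E)) (trans (proj₁ (proj₂ (c∥ adm e e<E))) (*-comm (c e) (proj₁ (c∥ adm e e<E))))

    gap : ∃[ w ] shift e + suc w ≡ i
    gap = proj₁ o , trans (+-suc (shift e) (proj₁ o)) (proj₂ o)
      where o = m≤n⇒∃[o]m+o≡n (≤-<-trans (shift≤K e<E) K<i)

    gap≤i : suc (proj₁ gap) ≤ i
    gap≤i = ≤-trans (m≤n+m (suc (proj₁ gap)) (shift e)) (≤-reflexive (proj₂ gap))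

    gcd-c≤i : gcd (c e) (x * x + i) ≤ i
    gcd-c≤i = ≤-trans (∣⇒≤ (gcd∣gap (x * x) (shift e) (suc (proj₁ gap)) c∣ (proj₂ gap))) gap≤i

    -- The gcd divides `i - shift e`, which is positive and at most `B`, so it divides `F` and is
    -- coprime to `c e`.
    gcd-c≤1 : i ≤ B → gcd (c e) (x * x + i) ≤ 1
    gcd-c≤1 i≤B = ≤-reflexive (c⊥∣F e (≤⇒∣! (≤-trans gap≤i i≤B)) (gcd[m,n]∣m (c e) (x * x + i) , gcd∣gap (x * x) (shift e) (suc (proj₁ gap)) c∣ (proj₂ gap)))

-- From the moduli to the digits at one square

∏-lower : ∀ n {f} → (∀ e → 2 ≤ f e) → suc n ≤ ∏ n f
∏-lower zero    h = ≤-refl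
∏-lower (suc n) {f} h = ≤-trans (s≤s (≤-trans (s≤s (m≤m+n n (n + 0))) (≤-reflexive (sym (+-suc n (n + 0)))))) (*-mono-≤ (h n) (∏-lower n h))

square≤eighth : ∀ n → n * n ≤ n ^ 8
square≤eighth zero    = z≤n
square≤eighth n@(suc _) = ≤-trans (≤-reflexive (cong (n *_) (sym (*-identityʳ n)))) (^-monoʳ-≤ n {2} {8} (s≤s (s≤s z≤n)))

^-cancelʳ-≤ : ∀ k {a b} → a ^ suc k ≤ b ^ suc k → a ≤ b
^-cancelʳ-≤ k a^≤b^ = ≮⇒≥ λ b<a → <⇒≱ (^-monoˡ-< (suc k) b<a) a^≤b^

-- `d (s * s)` is odd, and multiplication by 3 exchanges the classes 1 and 3 modulo 4.
d-square-mod4 : ∀ s .{{_ : NonZero s}} → d (s * s) % 4 ≡ 3 ⊎ (3 * d (s * s)) % 4 ≡ 3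
d-square-mod4 s = from (d-square-odd s)
  where
  halve : ∀ q → (∃[ w ] q ≡ w + w) ⊎ (∃[ w ] q ≡ suc (w + w))
  halve zero = inj₁ (0 , refl)
  halve (suc q) with halve q
  ... | inj₁ (w , refl) = inj₂ (w , refl)
  ... | inj₂ (w , refl) = inj₁ (suc w , cong suc (sym (+-suc w w)))
  lemma₁ : ∀ w → 3 * (2 * (w + w) + 1) ≡ 3 + 3 * w * 4
  lemma₁ = solve-∀
  lemma₂ : ∀ w → 2 * suc (w + w) + 1 ≡ 3 + w * 4
  lemma₂ = solve-∀
  from : ∃[ q ] d (s * s) ≡ 2 * q + 1 → d (s * s) % 4 ≡ 3 ⊎ (3 * d (s * s)) % 4 ≡ 3
  from (q , eq) with halve q
  ... | inj₁ (w , refl) = inj₂ (trans (cong (λ n → (3 * n) % 4) eq) (trans (cong (_% 4) (lemma₁ w)) ([m+kn]%n≡m%n 3 (3 * w) 4)))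
  ... | inj₂ (w , refl) = inj₁ (trans (cong (_% 4) eq) (trans (cong (_% 4) (lemma₂ w)) ([m+kn]%n≡m%n 3 w 4)))

≡2mod4⇒double-odd : ∀ {x} → x ≡ 2 [mod 4 ] → ∃[ q ] x ≡ 2 * suc (2 * q)
≡2mod4⇒double-odd {x} (modular k l eq) = x / 4 , trans (m≡m%n+[m/n]*n x 4) (trans (cong (_+ x / 4 * 4) x%4≡2) (lemma (x / 4)))
  where
  x%4≡2 : x % 4 ≡ 2
  x%4≡2 = trans (sym ([m+kn]%n≡m%n x k 4)) (trans (cong (_% 4) eq) ([m+kn]%n≡m%n 2 l 4))
  lemma : ∀ q → 2 + q * 4 ≡ 2 * suc (2 * q)
  lemma = solve-∀

odd⊥4 : ∀ q → Coprime 4 (suc (2 * q) * suc (2 * q))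
odd⊥4 q = coprime-* {2} {2} 2⊥ 2⊥
  where
  2⊥ : Coprime 2 (suc (2 * q) * suc (2 * q))
  2⊥ {k} (k∣2 , k∣s²) = ∣1⇒≡1 (∣m+n∣m⇒∣n (subst (k ∣_) (lemma q) k∣s²) (∣m⇒∣m*n (2 * (q + q * q)) k∣2))
    where lemma : ∀ q → suc (2 * q) * suc (2 * q) ≡ 2 * (2 * (q + q * q)) + 1
          lemma = solve-∀

digits-at-square : ∀ {m} S K → m < S → 2 ≤ S → 4 ≤ K → d (S * S) % 4 ≡ 3 → (∀ i → 1 ≤ i → i ≤ K → 2 ^ (2 + i) ∣ d (S * S + i)) →
                   (∀ i → K < i → d (S * S + i) * d (S * S + i) ≤ 2 ^ i) →
                   ∃[ n ] (m < n × EBinaryDigit≡ n 1 × EBinaryDigit≡ (suc n) 1)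
digits-at-square (suc (suc s)) K m<S _ 4≤K mod3 div small =
  pred (S * S) , ≤-trans m<S (s≤s (bound s)) , square-digits s K 4≤K mod3 div small
  where
  S = 2 + s
  bound : ∀ s → suc s ≤ s + suc s * (2 + s)
  bound s = ≤-trans (m≤m*n (suc s) (2 + s)) (m≤n+m (suc s * (2 + s)) s)

-- One even x serves both x and x/2 because 4((x/2)² + i) = x² + 4i.
module Conclusion (x K′ : ℕ) (4≤K′ : 4 ≤ K′) {m} (m-small : 2 * suc (suc m) ≤ x) (x≡2 : x ≡ 2 [mod 4 ])
  (div : ∀ i → 1 ≤ i → i ≤ 4 * K′ → 2 ^ (2 + i) ∣ d (x * x + i))
  (div/4 : ∀ n i .{{_ : NonZero n}} → 1 ≤ i → i ≤ K′ → 4 * n ≡ x * x + 4 * i → 2 ^ (2 + i) ∣ d n)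
  (small : ∀ i → 4 * K′ < i → d (x * x + i) ^ 8 ≤ 2 ^ i) where

  conclusion : ∃[ n ] (m < n × EBinaryDigit≡ n 1 × EBinaryDigit≡ (suc n) 1)
  conclusion = from (≡2mod4⇒double-odd x≡2)
    where
    from : ∃[ q ] x ≡ 2 * suc (2 * q) → ∃[ n ] (m < n × EBinaryDigit≡ n 1 × EBinaryDigit≡ (suc n) 1)
    from (q , x≡2s) = choose (d-square-mod4 s)
      where
      s = suc (2 * q)
      m<s : suc (suc m) ≤ s
      m<s = *-cancelˡ-≤ 2 (≤-trans m-small (≤-reflexive x≡2s))
      quadruple : ∀ s i → 4 * (s * s + i) ≡ 2 * s * (2 * s) + 4 * i
      quadruple = solve-∀
      4n≡ : ∀ i → 4 * (s * s + i) ≡ x * x + 4 * i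
      4n≡ i = trans (quadruple s i) (cong (λ y → y * y + 4 * i) (sym x≡2s))
      -- The shift `i` at `s` is the shift `4 * i` at `x`, so `d² ≤ 2^i` at `s` needs `d^8 ≤ 2^(4i)`
      -- at `x`. This is the reason for the eighth power.
      small-s : ∀ i → K′ < i → d (s * s + i) * d (s * s + i) ≤ 2 ^ i
      small-s i K′<i = ^-cancelʳ-≤ 3 (begin
        (D * D) ^ 4            ≡⟨ eighth D ⟩
        D ^ 8                  ≤⟨ ^-monoˡ-≤ 8 (d-mono-∣ {s * s + i} {x * x + 4 * i} {{_}} {{nz}} (divides 4 (sym (4n≡ i)))) ⟩
        d (x * x + 4 * i) ^ 8  ≤⟨ small (4 * i) (*-monoʳ-< 4 K′<i) ⟩
        2 ^ (4 * i)            ≡⟨ cong (2 ^_) (*-comm 4 i) ⟩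
        2 ^ (i * 4)            ≡⟨ ^-*-assoc 2 i 4 ⟨
        (2 ^ i) ^ 4            ∎)
        where
        open ≤-Reasoning
        D = d (s * s + i)
        eighth : ∀ a → (a * a) * ((a * a) * ((a * a) * ((a * a) * 1))) ≡ a * (a * (a * (a * (a * (a * (a * (a * 1)))))))
        eighth = solve-∀
        nz : NonZero (x * x + 4 * i)
        nz = subst NonZero (4n≡ i) _
      d-x² : d (x * x) ≡ 3 * d (s * s)
      d-x² = trans (cong d (trans (cong (λ y → y * y) x≡2s) (rearrange s))) (d-coprime 4 (s * s) (odd⊥4 q))
        where rearrange : ∀ s → 2 * s * (2 * s) ≡ 4 * (s * s)
              rearrange = solve-∀
      choose : d (s * s) % 4 ≡ 3 ⊎ (3 * d (s * s)) % 4 ≡ 3 → _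
      choose (inj₁ mod3) = digits-at-square s K′ (<⇒≤ m<s) (≤-trans (s≤s (s≤s z≤n)) m<s) 4≤K′ mod3
        (λ i 1≤i i≤K′ → div/4 (s * s + i) i 1≤i i≤K′ (4n≡ i)) small-s
      choose (inj₂ mod3) = digits-at-square x (4 * K′) (≤-trans (≤-trans (n≤1+n (suc m)) (m≤n*m (suc (suc m)) 2)) m-small)
        (≤-trans (≤-trans (s≤s (s≤s z≤n)) (m≤n*m (suc (suc m)) 2)) m-small) (≤-trans 4≤K′ (m≤n*m K′ 4))
        (trans (cong (_% 4) d-x²) mod3) div (λ i K<i → ≤-trans (square≤eighth (d (x * x + i))) (small i K<i))

eighth-power≤ : ∀ {n i} e → n ≤ 2 ^ e → e * 8 ≤ i → n ^ 8 ≤ 2 ^ i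
eighth-power≤ e n≤ e8≤i = ≤-trans (^-monoˡ-≤ 8 n≤) (≤-trans (≤-reflexive (^-*-assoc 2 e 8)) (^-monoʳ-≤ 2 e8≤i))

-- The left side is the exponent of `((2 * 2^(i/48))^3)^8`. With 48 twice 24, the powers of
-- `2^(i/48)` use half of `i`, and the constant 24 fits in the other half once `48 ≤ i`; hence
-- `12 ≤ K′`.
24*suc[i/48]≤i : ∀ {i} → 48 ≤ i → suc (i / 48) * 3 * 8 ≤ i
24*suc[i/48]≤i {i} 48≤i = ≮⇒≥ λ lt → <⇒≱ (+-mono-< lt lt) (≤-trans (≤-reflexive (lemma (i / 48))) (+-mono-≤ 48≤i (m/n*n≤m i 48)))
  where
  lemma : ∀ y → suc y * 3 * 8 + suc y * 3 * 8 ≡ 48 + y * 48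
  lemma = solve-∀

module Assembly (K′ L B : ℕ) .{{_ : NonZero L}} (B-large : 4 * K′ * (4 * K′ * L * (4 * K′ * L)) ≤ B) (4≤B : 4 ≤ B) where

  K : ℕ
  K = 4 * K′

  open Moduli K L B B-large 4≤B

  modulus-lower : suc E ≤ modulus
  modulus-lower = ≤-trans (∏-lower E {λ e → c e * c e} (λ e → *-mono-≤ {2} {c e} {1} (c≥2 e) (s≤s z≤n))) (m≤m*n (∏ E (λ e → c e * c e)) 4)
    where
    c≥2 : ∀ e → 2 ≤ c e
    c≥2 e = s≤s (n≢0⇒n>0 (≢-nonZero⁻¹ (v e * (F * F)) {{m*n≢0 (v e) (F * F) {{_}} {{m*n≢0 F F {{B !≢0}} {{B !≢0}}}}}}))

  modulus-upper : modulus ≤ (suc (B * (F * F)) * suc (B * (F * F))) ^ E * 4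
  modulus-upper = *-monoˡ-≤ 4 (∏≤^ E {λ e → c e * c e} (λ e e<E → *-mono-≤ (c≤ e<E) (c≤ e<E)))
    where
    c≤ : ∀ {e} → e < E → c e ≤ suc (B * (F * F))
    c≤ e<E = s≤s (*-monoˡ-≤ (F * F) (v≤B e<E))

  -- Beyond `K` there are three ranges of `i`. In `mid` the modulus shares at most 4 with the
  -- values, in `far` at most `(i * i) ^ E * 4`, and in `tail` the bound `d n ≤ n` is enough. `size`
  -- keeps `x * x + J` within `T ^ 3`, as three rounds of `d≤small-divisors` demand.
  module _ (m h J : ℕ) (m≤E : 2 * suc (suc m) ≤ E) (12≤K′ : 12 ≤ K′) (L-large : 2 * (2 + K) ≤ L)
    (size : 4 * (modulus * modulus) + J ≤ 2 ^ h)
    (mid : ∀ i → K < i → i < J → i ≤ B → suc J * (suc h ^ 4 * (2 * (4 * i * 4))) ≤ 2 ^ (i / 48))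
    (far : ∀ i → B < i → i < J → suc J * (suc h ^ 4 * (2 * (4 * i * ((i * i) ^ E * 4)))) ≤ 2 ^ (i / 48))
    (tail : ∀ i → J ≤ i → ((2 ^ h) ^ 3 + i) ^ 8 ≤ 2 ^ i)
    where

    T : ℕ
    T = 2 ^ h

    T≥1 : 1 ≤ T
    T≥1 = m^n>0 2 h

    module FromBase (x₁ : ℕ) (x₁<2M : x₁ < 2 * modulus) (M≤x₁ : modulus ≤ x₁) (admissible₁ : Admissible x₁) where

      rate-bound : ∀ i → K < i → i < J → suc J * (suc h ^ 4 * Averaging.rate x₁ modulus h i) ≤ 2 ^ (i / 48)
      rate-bound i K<i i<J with i ≤? B
      ... | yes i≤B = ≤-trans (*-monoʳ-≤ (suc J) (*-monoʳ-≤ (suc h ^ 4) (*-monoʳ-≤ 2 (*-monoʳ-≤ (4 * i)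
        (≤-trans (rootGcd≤ {x₁} {1} i {{>-nonZero (≤-<-trans z≤n K<i)}} (λ e e<E → gcd-c≤1 admissible₁ K<i e<E i≤B)) (≤-reflexive (cong (_* 4) (^-zeroˡ E)))))))) (mid i K<i i<J i≤B)
      ... | no i≰B = ≤-trans (*-monoʳ-≤ (suc J) (*-monoʳ-≤ (suc h ^ 4) (*-monoʳ-≤ 2 (*-monoʳ-≤ (4 * i)
        (rootGcd≤ {x₁} {i} i {{>-nonZero (≤-<-trans z≤n K<i)}} (λ e e<E → gcd-c≤i admissible₁ K<i e<E)))))) (far i (≰⇒> i≰B) i<J)

      good : ∃[ t ] (t < T × (∀ i → K < i → i < J → ∀ δ → δ ∣ quad x₁ modulus i t → δ ≤ T → d δ ≤ 2 ^ (i / 48)))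
      good = Averaging.exists-good x₁ modulus h K J (λ i → 2 ^ (i / 48)) (λ i → m^n≢0 2 (i / 48)) rate-bound

      module AtGood (t : ℕ) (t<T : t < T) (few : ∀ i → K < i → i < J → ∀ δ → δ ∣ quad x₁ modulus i t → δ ≤ T → d δ ≤ 2 ^ (i / 48)) where

        x : ℕ
        x = x₁ + t * modulus

        x-admissible : Admissible x
        x-admissible = admissible-mod {x₁} (modular 0 t (+-identityʳ _)) admissible₁

        x≤ : x ≤ 2 * (T * modulus)
        x≤ = begin
          x₁ + t * modulus              ≤⟨ +-monoˡ-≤ (t * modulus) (<⇒≤ x₁<2M) ⟩
          2 * modulus + t * modulus     ≡⟨ lemma modulus t ⟩
          (1 + suc t) * modulus         ≤⟨ *-monoˡ-≤ modulus (+-mono-≤ T≥1 t<T) ⟩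
          (T + T) * modulus             ≡⟨ lemma′ T modulus ⟩
          2 * (T * modulus)             ∎
          where
          open ≤-Reasoning
          lemma : ∀ M t → 2 * M + t * M ≡ (1 + suc t) * M
          lemma = solve-∀
          lemma′ : ∀ T M → (T + T) * M ≡ 2 * (T * M)
          lemma′ = solve-∀

        x²+J≤T³ : x * x + J ≤ T ^ 3
        x²+J≤T³ = begin
          x * x + J                                          ≤⟨ +-mono-≤ (*-mono-≤ x≤ x≤) (m≤m*n J (T * T) {{m*n≢0 T T {{>-nonZero T≥1}} {{>-nonZero T≥1}}}}) ⟩
          2 * (T * modulus) * (2 * (T * modulus)) + J * (T * T) ≡⟨ lemma T modulus J ⟩
          (4 * (modulus * modulus) + J) * (T * T)            ≤⟨ *-monoˡ-≤ (T * T) size ⟩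
          T * (T * T)                                        ≡⟨ cong (λ k → T * (T * k)) (*-identityʳ T) ⟨
          T ^ 3                                              ∎
          where
          open ≤-Reasoning
          lemma : ∀ T M J → 2 * (T * M) * (2 * (T * M)) + J * (T * T) ≡ (4 * (M * M) + J) * (T * T)
          lemma = solve-∀

        x²+i≢0 : ∀ {i} → K < i → NonZero (x * x + i)
        x²+i≢0 {i} K<i = >-nonZero (≤-trans (≤-<-trans z≤n K<i) (m≤n+m i (x * x)))

        small-mid : ∀ i → K < i → i < J → d (x * x + i) ^ 8 ≤ 2 ^ i
        small-mid i K<i i<J = eighth-power≤ (suc (i / 48) * 3) (≤-trans d≤ (≤-reflexive (^-*-assoc 2 (suc (i / 48)) 3)))
          (24*suc[i/48]≤i (≤-trans (*-monoʳ-≤ 4 12≤K′) (<⇒≤ K<i)))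
          where
          suc-pred-T : suc (pred T) ≡ T
          suc-pred-T = suc-pred T {{>-nonZero T≥1}}
          d≤ : d (x * x + i) ≤ (2 * 2 ^ (i / 48)) ^ 3
          d≤ = d≤small-divisors (pred T) 3 (x * x + i) {{x²+i≢0 K<i}}
            (subst (λ n → x * x + i < n ^ 3) (sym suc-pred-T) (≤-trans (+-monoʳ-< (x * x) i<J) x²+J≤T³))
            (λ δ δ∣ δ≤T → few i K<i i<J δ δ∣ (≤-trans δ≤T (≤-reflexive suc-pred-T)))

        small-all : ∀ i → K < i → d (x * x + i) ^ 8 ≤ 2 ^ i
        small-all i K<i = split (i <? J)
          where
          split : Dec (i < J) → d (x * x + i) ^ 8 ≤ 2 ^ i
          split (yes i<J) = small-mid i K<i i<J
          split (no i≮J)  = ≤-trans (^-monoˡ-≤ 8 (≤-trans (d≤n (x * x + i) {{x²+i≢0 K<i}}) (+-monoˡ-≤ i (≤-trans (m≤m+n (x * x) J) x²+J≤T³)))) (tail i (≮⇒≥ i≮J))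

        -- The shift `i′` and the exponent index `i` are separate because the shift `i` at `x/2` is
        -- the shift `4 * i` at `x`.
        powers : ∀ i′ i a n .{{_ : NonZero n}} → (∀ e → Coprime (c e) a) → i ≤ K → 1 ≤ i′ → i′ ≤ K → a * n ≡ x * x + i′ → 2 ^ (2 + i) ∣ d n
        powers (suc i′) i a n c⊥a i≤K _ i′≤K eq =
          2^∣d-admissible x-admissible (2 + i) (≤-trans (*-monoʳ-≤ 2 (+-monoʳ-≤ 2 i≤K)) L-large) i′ i′≤K a n c⊥a eq

        at-good : ∃[ n ] (m < n × EBinaryDigit≡ n 1 × EBinaryDigit≡ (suc n) 1)
        at-good = Conclusion.conclusion x K′ (≤-trans (s≤s (s≤s (s≤s (s≤s z≤n)))) 12≤K′)
          (≤-trans m≤E (≤-trans (n≤1+n E) (≤-trans modulus-lower (≤-trans M≤x₁ (m≤m+n x₁ (t * modulus))))))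
          (proj₁ x-admissible)
          (λ i 1≤i i≤K → powers i i 1 (x * x + i) {{>-nonZero (≤-trans 1≤i (m≤n+m i (x * x)))}} (λ e (_ , k∣1) → ∣1⇒≡1 k∣1) i≤K 1≤i i≤K (*-identityˡ (x * x + i)))
          (λ n i 1≤i i≤K′ eq → powers (4 * i) i 4 n c⊥4 (≤-trans i≤K′ (m≤n*m K′ 4)) (≤-trans 1≤i (m≤n*m i 4)) (*-monoʳ-≤ 4 i≤K′) eq)
          small-all

      from-base : ∃[ n ] (m < n × EBinaryDigit≡ n 1 × EBinaryDigit≡ (suc n) 1)
      from-base = AtGood.at-good (proj₁ good) (proj₁ (proj₂ good)) (proj₂ (proj₂ good))

    block-11 : ∃[ n ] (m < n × EBinaryDigit≡ n 1 × EBinaryDigit≡ (suc n) 1)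
    block-11 = start exists-admissible
      where
      start : ∃[ x ] (x < modulus × Admissible x) → _
      -- Adding `modulus` keeps the residue class and bounds the base from below, so that `x`
      -- exceeds `E` and with it the given `m`.
      start (x₀ , x₀<M , adm) = FromBase.from-base (x₀ + modulus)
        (≤-trans (+-monoˡ-< modulus x₀<M) (≤-reflexive (cong (modulus +_) (sym (+-identityʳ modulus)))))
        (m≤n+m modulus x₀)
        (admissible-mod {x₀} (modular 0 1 (trans (+-identityʳ _) (cong (x₀ +_) (sym (*-identityˡ modulus))))) adm)

-- Choice of parameters

*-≤2^ : ∀ {a b} x y → a ≤ 2 ^ x → b ≤ 2 ^ y → a * b ≤ 2 ^ (x + y)
*-≤2^ x y a≤ b≤ = ≤-trans (*-mono-≤ a≤ b≤) (≤-reflexive (sym (^-distribˡ-+-* 2 x y)))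

^-≤2^ : ∀ {a} x n → a ≤ 2 ^ x → a ^ n ≤ 2 ^ (x * n)
^-≤2^ x n a≤ = ≤-trans (^-monoˡ-≤ n a≤) (≤-reflexive (^-*-assoc 2 x n))

+-≤2^ : ∀ {a b} x → a ≤ 2 ^ x → b ≤ 2 ^ x → a + b ≤ 2 ^ suc x
+-≤2^ x a≤ b≤ = ≤-trans (+-mono-≤ a≤ b≤) (≤-reflexive (cong (2 ^ x +_) (sym (+-identityʳ (2 ^ x)))))

suc-≤2^ : ∀ {a} x → a ≤ 2 ^ x → suc a ≤ 2 ^ suc x
suc-≤2^ x a≤ = +-≤2^ x (m^n>0 2 x) a≤

*≤⇒≤/ : ∀ a {n i} .{{_ : NonZero n}} → a * n ≤ i → a ≤ i / n
*≤⇒≤/ a {n} an≤i = ≤-trans (≤-reflexive (sym (m*n/n≡m a n))) (/-monoˡ-≤ n an≤i)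

n!≤n^n : ∀ n → n ! ≤ n ^ n
n!≤n^n n = below n ≤-refl
  where
  below : ∀ k → k ≤ n → k ! ≤ n ^ k
  below zero    _   = ≤-refl
  below (suc k) k<n = *-mono-≤ k<n (below k (<⇒≤ k<n))

16*suc≤2^ : ∀ q → 8 ≤ q → suc q * 16 ≤ 2 ^ q
16*suc≤2^ q 8≤q = from (m≤n⇒∃[o]m+o≡n 8≤q)
  where
  step : ∀ o → suc (o + 8) * 16 ≤ 2 ^ (o + 8)
  step zero    = ≤ᵇ⇒≤ 144 256 _
  step (suc o) = ≤-trans (≤-reflexive (+-comm 16 _)) (+-≤2^ (o + 8) (step o) (≤-trans (m≤n*m 16 (suc (o + 8))) (step o)))
  from : ∃[ o ] 8 + o ≡ q → suc q * 16 ≤ 2 ^ q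
  from (o , eq) = subst (λ q → suc q * 16 ≤ 2 ^ q) (trans (+-comm o 8) eq) (step o)

-- The left side at `κ = k + 16` is `48 * (48 * κ + 184)`, the requirement of `mid`; 16 is the least
-- exponent for which it holds.
linear≤2^ : ∀ k → 2304 * (k + 16) + 8832 ≤ 2 ^ (k + 16)
linear≤2^ zero    = ≤ᵇ⇒≤ 45696 65536 _
linear≤2^ (suc k) = ≤-trans (≤-reflexive (lemma (k + 16))) (+-≤2^ (k + 16) (linear≤2^ k) (≤-trans 2304≤ (linear≤2^ k)))
  where
  lemma : ∀ a → 2304 * suc a + 8832 ≡ 2304 * a + 8832 + 2304
  lemma = solve-∀
  2304≤ : 2304 ≤ 2304 * (k + 16) + 8832
  2304≤ = ≤-trans (≤ᵇ⇒≤ 2304 8832 _) (m≤n+m 8832 (2304 * (k + 16)))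

module Parameters (κ : ℕ) (linear : 2304 * κ + 8832 ≤ 2 ^ κ) where

  linear′ : ∀ a b → a ≤ 2304 → b ≤ 8832 → a * κ + b ≤ 2 ^ κ
  linear′ a b a≤ b≤ = ≤-trans (+-mono-≤ (*-monoˡ-≤ κ a≤) b≤) linear

  -- Powers of two with exponents linear in `κ` reduce each condition to comparing exponents. `β` is
  -- dictated by `B-large`, `η` by `size` with 2 to spare, and `ε` is the exponent of the number of
  -- moduli. `J = 64 * h` gives `i / 16 ≥ 4 * h` in `tail`.
  K′ L β B η h J ε : ℕ
  K′ = 2 ^ κ
  L = 2 ^ (κ + 4)
  β = 5 * κ + 14
  B = 2 ^ β
  η = 8 * κ + 27
  h = 2 ^ η
  J = 2 ^ (η + 6)
  ε = 2 * κ + 6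

  K≡ : 4 * K′ ≡ 2 ^ (2 + κ)
  K≡ = sym (^-distribˡ-+-* 2 2 κ)

  E≡ : 4 * K′ * L ≡ 2 ^ ε
  E≡ = trans (cong (_* L) K≡) (trans (sym (^-distribˡ-+-* 2 (2 + κ) (κ + 4))) (cong (2 ^_) (lemma κ)))
    where lemma : ∀ κ → 2 + κ + (κ + 4) ≡ 2 * κ + 6
          lemma = solve-∀

  B-large : 4 * K′ * (4 * K′ * L * (4 * K′ * L)) ≤ B
  B-large = ≤-trans (*-≤2^ (2 + κ) (ε + ε) (≤-reflexive K≡) (*-≤2^ ε ε (≤-reflexive E≡) (≤-reflexive E≡)))
                    (≤-reflexive (cong (2 ^_) (lemma κ)))
    where lemma : ∀ κ → 2 + κ + (2 * κ + 6 + (2 * κ + 6)) ≡ 5 * κ + 14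
          lemma = solve-∀

  B≥2^2 : 2 ^ 2 ≤ B
  B≥2^2 = ^-monoʳ-≤ 2 {2} {β} (≤-trans (≤ᵇ⇒≤ 2 14 _) (m≤n+m 14 (5 * κ)))

  12≤K′ : 12 ≤ K′
  12≤K′ = linear′ 0 12 z≤n (≤ᵇ⇒≤ 12 8832 _)

  L-large : 2 * (2 + 4 * K′) ≤ L
  L-large = ≤-trans (*-≤2^ 1 (3 + κ) ≤-refl (+-≤2^ (2 + κ) (≤-trans (≤-trans (≤ᵇ⇒≤ 2 12 _) 12≤K′) (^-monoʳ-≤ 2 (m≤n+m κ 2))) (≤-reflexive K≡)))
                    (≤-reflexive (cong (2 ^_) (lemma κ)))
    where lemma : ∀ κ → 1 + (3 + κ) ≡ κ + 4
          lemma = solve-∀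

  -- Ties the size of the square to `κ`, so that growing `κ` pushes the digits beyond any `m`.
  E-lower : ∀ {m} → m ≤ κ → 2 * suc (suc m) ≤ 4 * K′ * L
  E-lower {m} m≤κ = begin
    2 * suc (suc m)      ≤⟨ *-monoʳ-≤ 2 (s≤s (s≤s m≤κ)) ⟩
    2 * suc (suc κ)      ≡⟨ lemma κ ⟩
    2 * κ + 4            ≤⟨ linear′ 2 4 (≤ᵇ⇒≤ 2 2304 _) (≤ᵇ⇒≤ 4 8832 _) ⟩
    K′                   ≤⟨ m≤n*m K′ 4 ⟩
    4 * K′               ≤⟨ m≤m*n (4 * K′) L {{m^n≢0 2 (κ + 4)}} ⟩
    4 * K′ * L           ∎
    where
    open ≤-Reasoning
    lemma : ∀ κ → 2 * suc (suc κ) ≡ 2 * κ + 4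
    lemma = solve-∀

  F≤ : B ! ≤ 2 ^ (β * B)
  F≤ = ≤-trans (n!≤n^n B) (^-≤2^ β B ≤-refl)

  a : ℕ
  a = suc (β + (β * B + β * B))

  c≤ : suc (B * (B ! * B !)) ≤ 2 ^ a
  c≤ = suc-≤2^ (β + (β * B + β * B)) (*-≤2^ β (β * B + β * B) ≤-refl (*-≤2^ (β * B) (β * B) F≤ F≤))

  a≤ : a ≤ 2 ^ (κ + (2 + β))
  -- Adding `2 * B` to `a` makes it factor as `(1 + β) * (1 + 2 * B)`.
  a≤ = ≤-trans (≤-trans (m≤m+n a (2 * B)) (≤-reflexive (lemma β B))) (*-≤2^ κ (2 + β) suc-β≤
    (≤-trans (s≤s (+-monoʳ-≤ B (≤-trans (+-monoʳ-≤ B z≤n) (m≤m+n (B + 0) B)))) (suc-2B≤)))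
    where
    lemma : ∀ β B → suc (β + (β * B + β * B)) + 2 * B ≡ suc β * suc (B + (B + 0))
    lemma = solve-∀
    suc-β≤ : suc β ≤ 2 ^ κ
    suc-β≤ = ≤-trans (≤-reflexive (+-comm 1 β)) (≤-trans (≤-reflexive (+-assoc (5 * κ) 14 1)) (linear′ 5 15 (≤ᵇ⇒≤ 5 2304 _) (≤ᵇ⇒≤ 15 8832 _)))
    suc-2B≤ : suc (B + (B + 0 + B)) ≤ 2 ^ (2 + β)
    suc-2B≤ = ≤-trans (≤-trans (≤-reflexive (+-comm 1 _)) (+-monoʳ-≤ (B + (B + 0 + B)) (m^n>0 2 β))) (≤-reflexive (lemma′ B))
      where lemma′ : ∀ B → B + (B + 0 + B) + B ≡ 2 * (2 * B)
            lemma′ = solve-∀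

  -- The logarithm of `4 * (M * M)` is at most `4 * (a * E) + 6`, where `4 * (a * E) ≤ 2^(8κ+24)`.
  -- Both summands are kept below `2^(h-1)`, hence the `suc` in `exponent` and `J-exponent`.
  size : ∀ {M} → M ≤ (suc (B * (B ! * B !)) * suc (B * (B ! * B !))) ^ (4 * K′ * L) * 4 → 4 * (M * M) + J ≤ 2 ^ h
  size {M} M≤ = ≤-trans (+-≤2^ (pred h) (≤-trans 4MM≤ (^-monoʳ-≤ 2 (≤-pred (≤-trans exponent (≤-reflexive (sym (suc-pred h {{m^n≢0 2 η}})))))))
                                        (^-monoʳ-≤ 2 (≤-pred (≤-trans J-exponent (≤-reflexive (sym (suc-pred h {{m^n≢0 2 η}})))))))
                        (≤-reflexive (cong (2 ^_) (suc-pred h {{m^n≢0 2 η}})))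
    where
    E = 4 * K′ * L
    b = (a + a) * E + 2
    M≤2^ : M ≤ 2 ^ b
    M≤2^ = ≤-trans M≤ (*-≤2^ ((a + a) * E) 2 (^-≤2^ (a + a) E (*-≤2^ a a c≤ c≤)) ≤-refl)
    4MM≤ : 4 * (M * M) ≤ 2 ^ (2 + (b + b))
    4MM≤ = *-≤2^ 2 (b + b) ≤-refl (*-≤2^ b b M≤2^ M≤2^)
    lemma : ∀ a E → suc (2 + ((a + a) * E + 2 + ((a + a) * E + 2))) ≡ 4 * (a * E) + 7
    lemma = solve-∀
    lemma′ : ∀ κ → 2 + (κ + (2 + (5 * κ + 14)) + (2 * κ + 6)) ≡ 8 * κ + 24
    lemma′ = solve-∀
    lemma″ : ∀ κ → suc (8 * κ + 24) + 2 ≡ 8 * κ + 27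
    lemma″ = solve-∀
    exponent : suc (2 + (b + b)) ≤ h
    exponent = begin
      suc (2 + (b + b))            ≡⟨ lemma a E ⟩
      4 * (a * E) + 7              ≤⟨ +-≤2^ (8 * κ + 24) (≤-trans (*-≤2^ 2 (κ + (2 + β) + ε) ≤-refl (*-≤2^ (κ + (2 + β)) ε a≤ (≤-reflexive E≡))) (≤-reflexive (cong (2 ^_) (lemma′ κ))))
                                         (≤-trans (linear′ 0 7 z≤n (≤ᵇ⇒≤ 7 8832 _)) (^-monoʳ-≤ 2 (≤-trans (m≤n*m κ 8) (m≤m+n (8 * κ) 24)))) ⟩
      2 ^ suc (8 * κ + 24)         ≤⟨ ^-monoʳ-≤ 2 (≤-trans (m≤m+n (suc (8 * κ + 24)) 2) (≤-reflexive (lemma″ κ))) ⟩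
      h                            ∎
      where open ≤-Reasoning
    J-exponent : suc (η + 6) ≤ h
    J-exponent = begin
      suc (η + 6)      ≡⟨ trans (cong suc (+-assoc (8 * κ) 27 6)) (sym (+-suc (8 * κ) 33)) ⟩
      8 * κ + 34       ≤⟨ linear′ 8 34 (≤ᵇ⇒≤ 8 2304 _) (≤ᵇ⇒≤ 34 8832 _) ⟩
      2 ^ κ            ≤⟨ ^-monoʳ-≤ 2 (≤-trans (m≤n*m κ 8) (m≤m+n (8 * κ) 27)) ⟩
      h                ∎
      where open ≤-Reasoning

  -- Shared by `mid` and `far`: apart from the gcd factor `g`, all factors are powers of `J`, `h`
  -- and constants, with total exponent `48 * κ + 182`.
  prefix : ∀ i g γ → i < J → g ≤ 2 ^ γ → suc J * (suc h ^ 4 * (2 * (4 * i * g))) ≤ 2 ^ (48 * κ + 182 + γ)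
  prefix i g γ i<J g≤ = ≤-trans
    (*-≤2^ (suc (η + 6)) (suc η * 4 + (1 + (2 + (η + 6) + γ))) (suc-≤2^ (η + 6) ≤-refl)
      (*-≤2^ (suc η * 4) (1 + (2 + (η + 6) + γ)) (^-≤2^ (suc η) 4 (suc-≤2^ η ≤-refl))
        (*-≤2^ 1 (2 + (η + 6) + γ) ≤-refl (*-≤2^ (2 + (η + 6)) γ (*-≤2^ 2 (η + 6) ≤-refl (<⇒≤ i<J)) g≤))))
    (≤-reflexive (cong (2 ^_) (lemma κ γ)))
    where
    lemma : ∀ κ γ → suc (8 * κ + 27 + 6) + (suc (8 * κ + 27) * 4 + (1 + (2 + (8 * κ + 27 + 6) + γ))) ≡ 48 * κ + 182 + γ
    lemma = solve-∀

  mid : ∀ i → 4 * K′ < i → i < J → i ≤ B → suc J * (suc h ^ 4 * (2 * (4 * i * 4))) ≤ 2 ^ (i / 48)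
  mid i K<i i<J _ = ≤-trans (prefix i 4 2 i<J ≤-refl) (^-monoʳ-≤ 2 (*≤⇒≤/ (48 * κ + 182 + 2) (begin
    (48 * κ + 182 + 2) * 48   ≡⟨ lemma κ ⟩
    2304 * κ + 8832           ≤⟨ linear ⟩
    K′                        ≤⟨ m≤n*m K′ 4 ⟩
    4 * K′                    ≤⟨ <⇒≤ K<i ⟩
    i                         ∎)))
    where
    open ≤-Reasoning
    lemma : ∀ κ → (48 * κ + 182 + 2) * 48 ≡ 2304 * κ + 8832
    lemma = solve-∀

  -- The gcd factor costs an exponent of about `E * log₂ (i * i)`, linear in `κ` times `2^ε`.
  -- Multiplied by 48 it still fits below `B = 2^β`, hence below `i`.
  far : ∀ i → B < i → i < J → suc J * (suc h ^ 4 * (2 * (4 * i * ((i * i) ^ (4 * K′ * L) * 4)))) ≤ 2 ^ (i / 48)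
  far i B<i i<J = ≤-trans (prefix i ((i * i) ^ E * 4) (δ * E + 2) i<J
      (*-≤2^ (δ * E) 2 (^-≤2^ δ E (*-≤2^ (η + 6) (η + 6) (<⇒≤ i<J) (<⇒≤ i<J))) ≤-refl))
    (^-monoʳ-≤ 2 (*≤⇒≤/ (48 * κ + 182 + (δ * E + 2)) (begin
      (48 * κ + 182 + (δ * E + 2)) * 48                     ≡⟨ lemma κ E ⟩
      2304 * κ + 8832 + (768 * κ + 3168) * E                ≤⟨ +-≤2^ (κ + ε) (≤-trans linear (^-monoʳ-≤ 2 (m≤m+n κ ε)))
                                                                 (*-≤2^ κ ε (linear′ 768 3168 (≤ᵇ⇒≤ 768 2304 _) (≤ᵇ⇒≤ 3168 8832 _)) (≤-reflexive E≡)) ⟩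
      2 ^ suc (κ + ε)                                       ≤⟨ ^-monoʳ-≤ 2 (≤-trans (m≤m+n (suc (κ + ε)) (2 * κ + 7)) (≤-reflexive (lemma′ κ))) ⟩
      B                                                     ≤⟨ <⇒≤ B<i ⟩
      i                                                     ∎)))
    where
    open ≤-Reasoning
    E = 4 * K′ * L
    δ = η + 6 + (η + 6)
    lemma : ∀ κ E → (48 * κ + 182 + ((8 * κ + 27 + 6 + (8 * κ + 27 + 6)) * E + 2)) * 48 ≡ 2304 * κ + 8832 + (768 * κ + 3168) * E
    lemma = solve-∀
    lemma′ : ∀ κ → suc (κ + (2 * κ + 6)) + (2 * κ + 7) ≡ 5 * κ + 14
    lemma′ = solve-∀

  tail : ∀ i → J ≤ i → ((2 ^ h) ^ 3 + i) ^ 8 ≤ 2 ^ i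
  tail i J≤i = eighth-power≤ (suc q) (+-≤2^ q (≤-trans (≤-reflexive (^-*-assoc 2 h 3)) (^-monoʳ-≤ 2 (≤-trans (*-monoʳ-≤ h (≤ᵇ⇒≤ 3 4 _)) 4h≤q))) i≤2^q) exponent
    where
    -- Both summands are at most `2^q`, so the eighth power is at most `2^(8 (q + 1))`, and
    -- `8 (q + 1) ≤ 16 q ≤ i`.
    q = i / 16
    4h≤q : h * 4 ≤ q
    4h≤q = *≤⇒≤/ (h * 4) (≤-trans (≤-reflexive (trans (*-assoc h 4 16) (sym (^-distribˡ-+-* 2 η 6)))) J≤i)
    8≤q : 8 ≤ q
    8≤q = ≤-trans (≤-trans (≤-trans (linear′ 0 8 z≤n (≤ᵇ⇒≤ 8 8832 _)) (^-monoʳ-≤ 2 (≤-trans (m≤n*m κ 8) (m≤m+n (8 * κ) 27)))) (m≤m*n h 4)) 4h≤q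
    i≤2^q : i ≤ 2 ^ q
    i≤2^q = ≤-trans (≤-trans (≤-reflexive (m≡m%n+[m/n]*n i 16)) (+-monoˡ-≤ (q * 16) (m%n≤n i 16))) (16*suc≤2^ q 8≤q)
    lemma : ∀ q → q * 8 + q * 8 ≡ q * 16
    lemma = solve-∀
    exponent : suc q * 8 ≤ i
    exponent = ≤-trans (+-monoˡ-≤ (q * 8) (≤-trans 8≤q (m≤m*n q 8))) (≤-trans (≤-reflexive (lemma q)) (m/n*n≤m i 16))

  block-11-beyond : ∀ m → m ≤ κ → ∃[ n ] (m < n × EBinaryDigit≡ n 1 × EBinaryDigit≡ (suc n) 1)
  block-11-beyond m m≤κ = block-11 m h J (E-lower m≤κ) 12≤K′ L-large (size modulus-upper) mid far tail
    where
    instance _ = m^n≢0 2 (κ + 4)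
    open Assembly K′ L B B-large B≥2^2

mainTheorem3 : ∀ (m : ℕ) → ∃[ n ] (m < n × EBinaryDigit≡ n 1 × EBinaryDigit≡ (suc n) 1)
mainTheorem3 m = Parameters.block-11-beyond (m + 16) (linear≤2^ m) m (m≤m+n m 16)
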